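{- Let $n\ge 3$ and $k\ge 3$. For every $\alpha\in\mathbf{A}_k(n)\setminus\{r_{n,k}\}$, at least one of $\mathrm{LastNonMax}(\alpha)$, $\mathrm{LastSymbol}(\alpha)$, $\mathrm{FirstNonMin}(\alpha)$, $\mathrm{SecondLastNonMax}(\alpha)$ lies in $\mathbf{A}_k(n)$, so $\mathrm{Par}(\alpha)\in\mathbf{A}_k(n)$ is well defined. Moreover, for every $\alpha\in\mathbf{A}_k(n)$ there is $t\ge 0$ with $\mathrm{Par}^t(\alpha)=r_{n,k}$. Consequently the relation $\alpha\mapsto\mathrm{Par}(\alpha)$ defines a rooted tree with vertex set $\mathbf{A}_k(n)$ and root $r_{n,k}$, in which each non-root $\alpha$ and its parent $\mathrm{Par}(\alpha)$ have rotations that differ in exactly one (first) position.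
   Context: Let $\Sigma=\{0,1,\dots,k-1\}$. Strings are compared lexicographically ($\alpha<\beta$ if $\alpha$ is a proper prefix of $\beta$, or $\alpha$ has the smaller symbol at the first index where they differ). For $\alpha=a_1\cdots a_n$, $\alpha^R=a_n\cdots a_1$; $[\alpha]$ is the set of rotations of $\alpha$. $\alpha$ is a necklace if it is the lexicographically smallest element of $[\alpha]$; a bracelet if it is the lexicographically smallest element of $[\alpha]\cup[\alpha^R]$. A necklace $\alpha$ is symmetric if $\alpha^R\in[\alpha]$, asymmetric otherwise. $\mathbf{A}_k(n)$ is the set of asymmetric bracelets of length $n$ over $\Sigma$. $r_{n,k}=0^{n-2}(k-2)(k-1)$. Operations on $\alpha=a_1\cdots a_n$: $\mathrm{LastNonMax}(\alpha)=a_1\cdots a_{j-1}(a_j+1)(k-1)^{n-j}$, where $j$ is the index of the last symbol different from $k-1$; $\mathrm{LastSymbol}(\alpha)$ is the necklace (smallest rotation) of $a_1\cdots a_{n-1}((a_n+1)\bmod k)$; $\mathrm{FirstNonMin}(\alpha)=0^{i-1}(a_i-1)a_{i+1}\cdots a_n$, where $i$ is the index of the first nonzero symbol; $\mathrm{SecondLastNonMax}(\alpha)=a_1\cdots a_{\ell-1}(a_\ell+1)a_{\ell+1}\cdots a_n$, where $\ell$ is the index of the second-last symbol different from $k-1$. Parent rule: for $\alpha\in\mathbf{A}_k(n)\setminus\{r_{n,k}\}$, $\mathrm{Par}(\alpha)$ is the first string in the list $\langle \mathrm{LastNonMax}(\alpha),\mathrm{LastSymbol}(\alpha),\mathrm{FirstNonMin}(\alpha),\mathrm{SecondLastNonMax}(\alpha)\rangle$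 that belongs to $\mathbf{A}_k(n)$. $\mathrm{Par}^t$ denotes $t$-fold iteration, $\mathrm{Par}^0(\alpha)=\alpha$. -}

module Defs where

open import Data.Fin.Base using (Fin)
open import Data.List.Base using (List; []; _∷_; _++_; _∷ʳ_; [_]; length; map; take; drop; upTo; reverse; replicate; head; last; unsnoc; find; findIndices; catMaybes; _[_]%=_)
open import Data.List.Membership.Propositional using (_∈_)
import Data.List.Membership.DecPropositional as DecMembership
import Data.List.Extrema as Extrema
import Data.List.Properties as List
import Data.List.Relation.Binary.Lex.Strict as Lex
open import Data.List.Relation.Unary.All using (All; all?)
open import Data.Maybe.Base as Maybe using (Maybe; just; nothing; _>>=_)
open import Data.Nat.Base using (ℕ; zero; suc; pred; _∸_; _%_; _<_; NonZero)
import Data.Nat.Properties as ℕ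
open import Data.Product.Base using (∃; ∃₂; _×_; _,_)
open import Data.Product using (∃!)
open import Relation.Binary.Bundles using (DecTotalOrder)
open import Relation.Binary.Core using (Rel)
open import Relation.Binary.Definitions using (DecidableEquality)
open import Relation.Binary.PropositionalEquality.Core using (_≡_; _≢_)
open import Relation.Nullary.Negation.Core using (¬_)
open import Relation.Nullary.Decidable using (Dec; yes; no; _×-dec_; ¬?)
open import Relation.Unary using (Pred; Decidable)
open import Level using (0ℓ)

-- Strings are lists of naturals; the alphabet {0,…,k-1} and the length n
-- are imposed by membership in A_k(n), see IsAsymmetricBracelet.
String : Set
String = List ℕ

infix 4 _≟ˢ_ _≤ˡᵉˣ_ _≤ˡᵉˣ?_

_≟ˢ_ : DecidableEquality String
_≟ˢ_ = List.≡-dec ℕ._≟_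

_≤ˡᵉˣ_ : Rel String 0ℓ
_≤ˡᵉˣ_ = Lex.Lex-≤ _≡_ _<_

lexOrder : DecTotalOrder 0ℓ 0ℓ 0ℓ
lexOrder = Lex.≤-decTotalOrder ℕ.<-strictTotalOrder

_≤ˡᵉˣ?_ : ∀ α β → Dec (α ≤ˡᵉˣ β)
_≤ˡᵉˣ?_ = DecTotalOrder._≤?_ lexOrder

rotations : String → List String
rotations α = map (λ i → drop i α ++ take i α) (upTo (length α))

smallestRotation : String → String
smallestRotation α = Extrema.min (DecTotalOrder.totalOrder lexOrder) α (rotations α)

IsBracelet : Pred String 0ℓ
IsBracelet α = All (α ≤ˡᵉˣ_) (rotations α ++ rotations (reverse α))

IsSymmetric : Pred String 0ℓ
IsSymmetric α = reverse α ∈ rotations α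

-- α ∈ A_k(n)
record IsAsymmetricBracelet (k n : ℕ) (α : String) : Set where
  constructor mkAsymmetricBracelet
  field
    length≡n   : length α ≡ n
    alphabet   : All (_< k) α
    bracelet   : IsBracelet α
    asymmetric : ¬ IsSymmetric α

isAsymmetricBracelet? : ∀ k n → Decidable (IsAsymmetricBracelet k n)
isAsymmetricBracelet? k n α
  with length α ℕ.≟ n
     | all? (ℕ._<? k) α
     | all? (α ≤ˡᵉˣ?_) (rotations α ++ rotations (reverse α))
     | DecMembership._∈?_ _≟ˢ_ (reverse α) (rotations α)
... | yes p | yes q | yes r | no  s = yes (mkAsymmetricBracelet p q r s)
... | no ¬p | _     | _     | _     = no λ a → ¬p (IsAsymmetricBracelet.length≡n a)
... | yes _ | no ¬q | _     | _     = no λ a → ¬q (IsAsymmetricBracelet.alphabet a)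
... | yes _ | yes _ | no ¬r | _     = no λ a → ¬r (IsAsymmetricBracelet.bracelet a)
... | yes _ | yes _ | yes _ | yes s = no λ a → IsAsymmetricBracelet.asymmetric a s

-- 0ⁿ⁻²(k-2)(k-1)
root : (k n : ℕ) → String
root k n = replicate (n ∸ 2) 0 ++ (k ∸ 2) ∷ (k ∸ 1) ∷ []

-- The four operations are nothing exactly when the index they refer to does
-- not exist; this never happens on an asymmetric bracelet of length n ≥ 3.

nonMaxIndices : ℕ → (α : String) → List (Fin (length α))
nonMaxIndices k = findIndices (λ a → ¬? (a ℕ.≟ k ∸ 1))

nonMinIndices : (α : String) → List (Fin (length α))
nonMinIndices = findIndices (λ a → ¬? (a ℕ.≟ 0))

-- All symbols after the last non-maximal one equal k-1, so leaving them
-- unchanged yields the suffix (k-1)ⁿ⁻ʲ; dually for firstNonMin.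
lastNonMax : ℕ → String → Maybe String
lastNonMax k α = Maybe.map (λ j → α [ j ]%= suc) (last (nonMaxIndices k α))

lastSymbol : (k : ℕ) .{{_ : NonZero k}} → String → Maybe String
lastSymbol k α = Maybe.map (λ (β , a) → smallestRotation (β ∷ʳ (suc a % k))) (unsnoc α)

firstNonMin : String → Maybe String
firstNonMin α = Maybe.map (λ i → α [ i ]%= pred) (head (nonMinIndices α))

secondLastNonMax : ℕ → String → Maybe String
secondLastNonMax k α = Maybe.map (λ ℓ → α [ ℓ ]%= suc) (head (drop 1 (reverse (nonMaxIndices k α))))

-- The parent rule, with domain A_k(n) ∖ {root}.
par : (k n : ℕ) .{{_ : NonZero k}} → String → Maybe String
par k n α with isAsymmetricBracelet? k n α ×-dec ¬? (α ≟ˢ root k n)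
... | yes _ = find (isAsymmetricBracelet? k n)
                   (catMaybes (lastNonMax k α ∷ lastSymbol k α ∷ firstNonMin α ∷ secondLastNonMax k α ∷ []))
... | no  _ = nothing

par^ : (k n : ℕ) .{{_ : NonZero k}} → ℕ → String → Maybe String
par^ k n zero    α = just α
par^ k n (suc t) α = par k n α >>= par^ k n t

HaveRotationsDifferingInFirstPosition : Rel String 0ℓ
HaveRotationsDifferingInFirstPosition α β =
  ∃₂ λ a b → ∃ λ γ → a ≢ b × (a ∷ γ) ∈ rotations α × (b ∷ γ) ∈ rotations β

module _ {A : Set} (_⟶_ : Rel A 0ℓ) where

  -- Directed walks, indexed by the list of vertices visited.
  data Walk : A → A → List A → Set where
    stop : ∀ {x} → Walk x x [ x ]
    step : ∀ {x y z vs} → x ⟶ y → Walk y z vs → Walk x z (x ∷ vs)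

  -- A rooted tree with edges directed from child to parent (an in-arborescence):
  -- exactly one directed walk leads from each vertex to the root.  This
  -- forces every non-root vertex to have exactly one parent and the root none.
  record IsRootedTree (V : Pred A 0ℓ) (r : A) : Set where
    field
      root-vertex   : V r
      edge-vertices : ∀ {x y} → x ⟶ y → V x × V y
      unique-walk   : ∀ {x} → V x → ∃! _≡_ (Walk x r)

{-# OPTIONS --safe #-}

-- Write m = k − 1.  A bracelet is asymmetric iff it is strictly below every
-- rotation of its reversal, so membership in A_k(n) is a family of
-- inequalities between α = uv and vu, uᴿvᴿ.  If LastNonMax(α) breaks one of
-- them, then α = P mˢ (m−1) mᵗ with P a palindrome and s < t.  In that case
-- LastSymbol(α) is 0 followed by α without its last symbol, and if it fails
-- too, then t = s + 1.  Now FirstNonMin works if s > 0; if s = 0, then either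
-- α is the root or P = 0ᵉ(m−1)⋯(m−1)0ᵉ and SecondLastNonMax works.
--
-- Iteration terminates because each step decreases lexicographically: the
-- length of α without its leading zeros; then the first nonzero symbol,
-- counted as 0 when only m follows it; then Σ (m − aᵢ).
module Submission where

open import Defs
open import Data.Bool.Base using (true; false; if_then_else_)
open import Data.Fin.Base using (Fin; zero; suc)
open import Data.List.Base using (List; []; _∷_; _++_; _∷ʳ_; [_]; length; map; take; drop; reverse; replicate; head; last; unsnoc; find; findIndices; catMaybes; _[_]%=_; initLast; _∷ʳ′_)
import Data.List.Extrema as Extrema
open import Data.List.Membership.Propositional as Membership using (_∈_)
open import Data.List.Membership.Propositional.Properties using (∈-map⁺; ∈-map⁻; ∈-upTo⁺; ∈-++⁺ˡ; ∈-++⁺ʳ; ∈-++⁻)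
open import Data.List.Properties using (++-assoc; ++-identityʳ; length-++; length-++-comm; length-reverse; length-replicate; reverse-++; reverse-involutive; unfold-reverse; reverse-map; take++drop≡id; ∷-injective; ∷ʳ-injective)
open import Data.List.Relation.Binary.Lex.Core using (base; this; next)
open import Data.List.Relation.Binary.Pointwise using (Pointwise-≡⇒≡)
open import Data.List.Relation.Unary.All as All using (All; []; _∷_)
import Data.List.Relation.Unary.All.Properties as All
open import Data.List.Relation.Unary.Any as Any using (here; there)
import Data.List.Relation.Unary.Any.Properties as Any
open import Data.Maybe.Base as Maybe using (Maybe; just)
open import Data.Maybe.Properties using (just-injective)
open import Data.Maybe.Relation.Unary.Any using (Any; just)
open import Data.Nat.Base using (ℕ; zero; suc; pred; _+_; _∸_; _≤_; _<_; z≤n; s≤s; s≤s⁻¹; s<s⁻¹; NonZero)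
open import Data.Nat.DivMod using (n%n≡0)
open import Data.Nat.ListAction using (sum)
open import Data.Nat.Induction using (<-wellFounded)
import Data.Nat.Properties as ℕ
open import Data.Product.Base using (_×_; _,_; ∃; ∃₂; proj₂)
open import Data.Product.Relation.Binary.Lex.Strict using (×-Lex; ×-wellFounded)
open import Data.Sum.Base using (_⊎_; inj₁; inj₂)
open import Function.Base using (_∘_; _on_)
open import Induction.WellFounded using (WellFounded; Acc; acc)
open import Level using (0ℓ)
import Relation.Binary.Construct.On as On
open import Relation.Binary.Bundles using (DecTotalOrder)
open import Relation.Binary.Core using (Rel)
open import Relation.Binary.Definitions using (tri<; tri≈; tri>)
open import Relation.Binary.PropositionalEquality using (_≡_; _≢_; refl; sym; trans; cong; cong₂; subst; subst₂; module ≡-Reasoning)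
open import Relation.Nullary.Decidable using (Dec; yes; no; does; ¬?; _×-dec_; dec-true; dec-false)
open import Relation.Nullary.Negation using (¬_; contradiction)
open import Relation.Unary using (Pred; Decidable)

-- Rotation inequalities survive LastNonMax and LastSymbol whenever those are applied, so a failure
-- is always a factorisation uv of the new word with uᴿvᴿ not above it. After an increment, the part
-- u untouched by it must equal uᴿ, which is where the palindrome P comes from. After a zero has
-- been moved to the front, u must be a block of zeros, because any nonzero symbol in u settles the
-- comparison.
--
-- Let P = 0ᵉP₁, and let Z be what stands between P and the last symbol of α. The second failure
-- says that the reversal of P₁Z is at most P₁Z; this bounds P₁Z from below. Since P is a
-- palindrome, its zeros recur at its end, and the rotation of α that starts there bounds P₁Z from
-- above. The two bounds leave only t = s + 1, and for s = 0 they make m - 1 the first nonzero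
-- symbol of P, if there is one.
--
-- The rule takes the first candidate that works, even where the analysis only guarantees a later
-- one. The decrease therefore has to be proved for FirstNonMin also in the case meant for
-- SecondLastNonMax.

private
  variable
    a b c x : ℕ
    xs ys zs α β γ D E F : String

-- Lexicographic comparison

infix 4 _≺_

-- Unlike the strict lexicographic order, _≺_ requires a mismatch, so it is
-- insensitive to what is appended to either side.
data _≺_ : Rel String 0ℓ where
  differ : a < b → a ∷ xs ≺ b ∷ ys
  agree  : xs ≺ ys → a ∷ xs ≺ a ∷ ys

≤-refl : xs ≤ˡᵉˣ xs
≤-refl = DecTotalOrder.refl lexOrder

≤-reflexive : xs ≡ ys → xs ≤ˡᵉˣ ys
≤-reflexive refl = ≤-refl

≺⇒≤ : xs ≺ ys → xs ≤ˡᵉˣ ys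
≺⇒≤ (differ a<b) = this a<b
≺⇒≤ (agree p)    = next refl (≺⇒≤ p)

≤⇒≡⊎≺ : length xs ≡ length ys → xs ≤ˡᵉˣ ys → xs ≡ ys ⊎ xs ≺ ys
≤⇒≡⊎≺ eq (base _)   = inj₁ refl
≤⇒≡⊎≺ eq (this a<b) = inj₂ (differ a<b)
≤⇒≡⊎≺ eq (next refl p) with ≤⇒≡⊎≺ (ℕ.suc-injective eq) p
... | inj₁ refl = inj₁ refl
... | inj₂ q    = inj₂ (agree q)

≺⇒≱ : xs ≺ ys → ¬ ys ≤ˡᵉˣ xs
≺⇒≱ (differ a<b) (this b<a)      = ℕ.<-asym a<b b<a
≺⇒≱ (differ a<b) (next refl _)   = ℕ.<-irrefl refl a<b
≺⇒≱ (agree p)    (this a<a)      = ℕ.<-irrefl refl a<a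
≺⇒≱ (agree p)    (next _ q)      = ≺⇒≱ p q

≺-irrefl : ¬ xs ≺ xs
≺-irrefl p = ≺⇒≱ p ≤-refl

≺⊎≥ : length xs ≡ length ys → xs ≺ ys ⊎ ys ≤ˡᵉˣ xs
≺⊎≥ {[]}     {[]}     eq = inj₂ ≤-refl
≺⊎≥ {a ∷ xs} {b ∷ ys} eq with ℕ.<-cmp a b
... | tri< a<b _ _ = inj₁ (differ a<b)
... | tri> _ _ b<a = inj₂ (this b<a)
... | tri≈ _ refl _ with ≺⊎≥ {xs} {ys} (ℕ.suc-injective eq)
...   | inj₁ p = inj₁ (agree p)
...   | inj₂ p = inj₂ (next refl p)

≺-++ : xs ≺ ys → xs ++ E ≺ ys ++ F
≺-++ (differ a<b) = differ a<b
≺-++ (agree p)    = agree (≺-++ p)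

≺-++ˡ : ∀ zs → xs ≺ ys → zs ++ xs ≺ zs ++ ys
≺-++ˡ []       p = p
≺-++ˡ (_ ∷ zs) p = agree (≺-++ˡ zs p)

≤-++ˡ⁻ : ∀ zs → zs ++ xs ≤ˡᵉˣ zs ++ ys → xs ≤ˡᵉˣ ys
≤-++ˡ⁻ []       p          = p
≤-++ˡ⁻ (_ ∷ zs) (this a<a) = contradiction refl (ℕ.<⇒≢ a<a)
≤-++ˡ⁻ (_ ∷ zs) (next _ p) = ≤-++ˡ⁻ zs p

≺-++⁻ : length xs ≡ length ys → xs ++ E ≺ ys ++ F → xs ≺ ys ⊎ (xs ≡ ys × E ≺ F)
≺-++⁻ {[]}     {[]}     eq p            = inj₂ (refl , p)
≺-++⁻ {a ∷ xs} {b ∷ ys} eq (differ a<b) = inj₁ (differ a<b)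
≺-++⁻ {a ∷ xs} {b ∷ ys} eq (agree p) with ≺-++⁻ {xs} {ys} (ℕ.suc-injective eq) p
... | inj₁ q          = inj₁ (agree q)
... | inj₂ (refl , q) = inj₂ (refl , q)

≤-head : a ∷ xs ≤ˡᵉˣ b ∷ ys → a ≤ b
≤-head (this a<b)    = ℕ.<⇒≤ a<b
≤-head (next refl _) = ℕ.≤-refl

≤-tail : b ≤ a → a ∷ xs ≤ˡᵉˣ b ∷ ys → a ≡ b × xs ≤ˡᵉˣ ys
≤-tail b≤a (this a<b)    = contradiction b≤a (ℕ.<⇒≱ a<b)
≤-tail b≤a (next refl p) = refl , p

<-head⇒≺ : All (a <_) ys → a < b → a ∷ xs ≺ ys ++ b ∷ zs
<-head⇒≺ []        a<b = differ a<b
<-head⇒≺ (a<c ∷ _) a<b = differ a<c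

-- Raising a symbol of both sides preserves xs ++ E ≤ w ++ c ∷ D when the
-- raised symbol occurs earlier on the right.
raise-≺ : ∀ {c′} xs w → length w < length xs → c < c′ →
          xs ++ E ≤ˡᵉˣ w ++ c ∷ D → xs ++ F ≺ w ++ c′ ∷ zs
raise-≺ (a ∷ xs) []      l c<c′ p             = differ (ℕ.≤-<-trans (≤-head p) c<c′)
raise-≺ (a ∷ xs) (b ∷ w) l c<c′ (this a<b)    = differ a<b
raise-≺ (a ∷ xs) (b ∷ w) l c<c′ (next refl p) = agree (raise-≺ xs w (s<s⁻¹ l) c<c′ p)

-- List lemmas

++-split : ∀ (u : String) {v} xs {ys} → u ++ v ≡ xs ++ ys →
           (∃ λ w → xs ≡ u ++ w × v ≡ w ++ ys) ⊎
           (∃₂ λ b w → u ≡ xs ++ b ∷ w × ys ≡ b ∷ w ++ v)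
++-split []      xs       eq   = inj₁ (xs , refl , eq)
++-split (a ∷ u) []       refl = inj₂ (a , u , refl , refl)
++-split (a ∷ u) (b ∷ xs) eq with ∷-injective eq
... | refl , eq′ with ++-split u xs eq′
...   | inj₁ (w , refl , q)        = inj₁ (w , refl , q)
...   | inj₂ (b′ , w , refl , q)   = inj₂ (b′ , w , refl , q)

replicate-∷ʳ : ∀ n (a : ℕ) → replicate n a ∷ʳ a ≡ a ∷ replicate n a
replicate-∷ʳ zero    a = refl
replicate-∷ʳ (suc n) a = cong (a ∷_) (replicate-∷ʳ n a)

replicate-∷ : ∀ n (a : ℕ) xs → replicate n a ++ a ∷ xs ≡ a ∷ replicate n a ++ xs
replicate-∷ zero    a xs = refl
replicate-∷ (suc n) a xs = cong (a ∷_) (replicate-∷ n a xs)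

reverse-replicate : ∀ n (a : ℕ) → reverse (replicate n a) ≡ replicate n a
reverse-replicate zero    a = refl
reverse-replicate (suc n) a = begin
  reverse (a ∷ replicate n a)    ≡⟨ unfold-reverse a (replicate n a) ⟩
  reverse (replicate n a) ∷ʳ a   ≡⟨ cong (_∷ʳ a) (reverse-replicate n a) ⟩
  replicate n a ∷ʳ a             ≡⟨ replicate-∷ʳ n a ⟩
  a ∷ replicate n a              ∎
  where open ≡-Reasoning

reverse-mid : ∀ xs (a : ℕ) ys → reverse (xs ++ a ∷ ys) ≡ reverse ys ++ a ∷ reverse xs
reverse-mid xs a ys = begin
  reverse (xs ++ a ∷ ys)              ≡⟨ reverse-++ xs (a ∷ ys) ⟩
  reverse (a ∷ ys) ++ reverse xs      ≡⟨ cong (_++ reverse xs) (unfold-reverse a ys) ⟩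
  (reverse ys ∷ʳ a) ++ reverse xs     ≡⟨ ++-assoc (reverse ys) [ a ] (reverse xs) ⟩
  reverse ys ++ a ∷ reverse xs        ∎
  where open ≡-Reasoning

All-reverse : ∀ {P : Pred ℕ 0ℓ} → All P xs → All P (reverse xs)
All-reverse ps = All.tabulate (λ p → All.lookup ps (Any.reverse⁻ p))

length-reverse-++ : ∀ (u v : String) → length (u ++ v) ≡ length (reverse u ++ reverse v)
length-reverse-++ u v = begin
  length (u ++ v)                          ≡⟨ length-++ u ⟩
  length u + length v                      ≡⟨ cong₂ _+_ (length-reverse u) (length-reverse v) ⟨
  length (reverse u) + length (reverse v)  ≡⟨ length-++ (reverse u) ⟨
  length (reverse u ++ reverse v)          ∎
  where open ≡-Reasoning

length-replace : ∀ (xs : String) {a b : ℕ} {ys} → length (xs ++ a ∷ ys) ≡ length (xs ++ b ∷ ys)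
length-replace xs = trans (length-++ xs) (sym (length-++ xs))

-- Asymmetric bracelets in terms of factorisations

take-length : ∀ (u : String) {v} → take (length u) (u ++ v) ≡ u
take-length []      = refl
take-length (a ∷ u) = cong (a ∷_) (take-length u)

drop-length : ∀ (u : String) {v} → drop (length u) (u ++ v) ≡ v
drop-length []      = refl
drop-length (_ ∷ u) = drop-length u

∈-rotations⁻ : β ∈ rotations α → ∃₂ λ u v → u ++ v ≡ α × β ≡ v ++ u
∈-rotations⁻ {α = α} β∈ with ∈-map⁻ _ β∈
... | i , _ , eq = take i α , drop i α , take++drop≡id i α , eq

∷-∈-rotations : ∀ u a v → a ∷ v ++ u ∈ rotations (u ++ a ∷ v)
∷-∈-rotations u a v = subst (_∈ rotations (u ++ a ∷ v))
  (cong₂ _++_ (drop-length u) (take-length u))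
  (∈-map⁺ _ (∈-upTo⁺ (subst (length u <_) (sym (length-++ u)) (ℕ.m<m+n (length u) (s≤s z≤n)))))

∈-rotations⁺ : ∀ u v → 0 < length (u ++ v) → v ++ u ∈ rotations (u ++ v)
∈-rotations⁺ u       (a ∷ v) _ = ∷-∈-rotations u a v
∈-rotations⁺ (a ∷ u) []      _ rewrite ++-identityʳ u =
  subst (_∈ rotations (a ∷ u)) (cong (a ∷_) (++-identityʳ u)) (∷-∈-rotations [] a u)

-- The strict inequality combines the bracelet condition with asymmetry.
record Reduced (α : String) : Set where
  field
    rotation   : ∀ u v → u ++ v ≡ α → α ≤ˡᵉˣ v ++ u
    reflection : ∀ u v → u ++ v ≡ α → α ≺ reverse u ++ reverse v

open Reduced

reduced⇒isBracelet : Reduced α → IsBracelet α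
reduced⇒isBracelet {α} r = All.tabulate bound
  where
  bound : β ∈ rotations α ++ rotations (reverse α) → α ≤ˡᵉˣ β
  bound β∈ with ∈-++⁻ (rotations α) β∈
  ... | inj₁ p with ∈-rotations⁻ p
  ...   | u , v , eq , refl = rotation r u v eq
  bound β∈ | inj₂ p with ∈-rotations⁻ p
  ...   | u , v , eq , refl = subst (α ≤ˡᵉˣ_)
    (cong₂ _++_ (reverse-involutive v) (reverse-involutive u))
    (≺⇒≤ (reflection r (reverse v) (reverse u) (begin
      reverse v ++ reverse u   ≡⟨ reverse-++ u v ⟨
      reverse (u ++ v)         ≡⟨ cong reverse eq ⟩
      reverse (reverse α)      ≡⟨ reverse-involutive α ⟩
      α                        ∎)))
    where open ≡-Reasoning

reduced⇒¬isSymmetric : Reduced α → ¬ IsSymmetric α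
reduced⇒¬isSymmetric {α} r sy with ∈-rotations⁻ sy
... | u , v , eq , eq′ = ≺-irrefl (subst (α ≺_) (begin
      reverse u ++ reverse v   ≡⟨ reverse-++ v u ⟨
      reverse (v ++ u)         ≡⟨ cong reverse eq′ ⟨
      reverse (reverse α)      ≡⟨ reverse-involutive α ⟩
      α                        ∎) (reflection r u v eq))
    where open ≡-Reasoning

asymmetricBracelet⇒reduced : ∀ {k n} → 0 < n → IsAsymmetricBracelet k n α → Reduced α
asymmetricBracelet⇒reduced {α} 0<n A = record { rotation = rot ; reflection = ref }
  where
  open IsAsymmetricBracelet A
  0<length : 0 < length α
  0<length = subst (0 <_) (sym length≡n) 0<n

  rot : ∀ u v → u ++ v ≡ α → α ≤ˡᵉˣ v ++ u
  rot u v refl = All.lookup bracelet (∈-++⁺ˡ (∈-rotations⁺ u v 0<length))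

  ref : ∀ u v → u ++ v ≡ α → α ≺ reverse u ++ reverse v
  ref u v refl with ≤⇒≡⊎≺ (length-reverse-++ u v)
    (All.lookup bracelet (∈-++⁺ʳ (rotations α)
      (subst (λ β → reverse u ++ reverse v ∈ rotations β) (sym (reverse-++ u v))
        (∈-rotations⁺ (reverse v) (reverse u) (subst (0 <_)
          (trans (sym (length-reverse α)) (cong length (reverse-++ u v))) 0<length)))))
  ... | inj₂ p = p
  -- Equality would make the reversal of `α` the rotation `v ++ u`.
  ... | inj₁ p = contradiction
    (subst (_∈ rotations α) (sym (begin
      reverse α                                   ≡⟨ cong reverse p ⟩
      reverse (reverse u ++ reverse v)            ≡⟨ reverse-++ (reverse u) (reverse v) ⟩
      reverse (reverse v) ++ reverse (reverse u)  ≡⟨ cong₂ _++_ (reverse-involutive v) (reverse-involutive u) ⟩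
      v ++ u                                      ∎)) (∈-rotations⁺ u v 0<length))
    asymmetric
    where open ≡-Reasoning

-- Turns a failure into data: a search through the finitely many rotations of the reversal returns
-- the offending factorisation, whose shape is then analysed.
reduced⊎failure : 0 < length α → (∀ u v → u ++ v ≡ α → α ≤ˡᵉˣ v ++ u) →
  Reduced α ⊎ (∃₂ λ u v → u ++ v ≡ α × reverse u ++ reverse v ≤ˡᵉˣ α)
reduced⊎failure {α} 0<length rot with Any.any? (_≤ˡᵉˣ? α) (rotations (reverse α))
... | yes p with Membership.find p
...   | β , β∈ , β≤α with ∈-rotations⁻ β∈
...     | u , v , eq , refl = inj₂ (reverse v , reverse u ,
  trans (sym (reverse-++ u v)) (trans (cong reverse eq) (reverse-involutive α)) ,
  subst (_≤ˡᵉˣ α) (sym (cong₂ _++_ (reverse-involutive v) (reverse-involutive u))) β≤α)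
reduced⊎failure {α} 0<length rot | no ¬p = inj₁ (record { rotation = rot ; reflection = ref })
  where
  ref : ∀ u v → u ++ v ≡ α → α ≺ reverse u ++ reverse v
  ref u v refl with ≺⊎≥ (length-reverse-++ u v)
  ... | inj₁ q = q
  ... | inj₂ q = contradiction
    (Membership.lose (subst (λ β → reverse u ++ reverse v ∈ rotations β) (sym (reverse-++ u v))
      (∈-rotations⁺ (reverse v) (reverse u) (subst (0 <_)
          (trans (sym (length-reverse α)) (cong length (reverse-++ u v))) 0<length))) q) ¬p

reduced-head : ∀ a xs → Reduced (a ∷ xs ++ b ∷ ys) → a ≤ b
reduced-head a xs r = ≤-head (rotation r (a ∷ xs) _ refl)

smallestRotation-∷ʳ : (∀ u v → u ++ v ≡ a ∷ γ → a ∷ γ ≤ˡᵉˣ v ++ u) → smallestRotation (γ ∷ʳ a) ≡ a ∷ γ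
smallestRotation-∷ʳ {a} {γ} rot = Pointwise-≡⇒≡
  -- The last argument bounds the default value of `Extrema.min`, which is the unrotated word
  -- `γ ∷ʳ a`.
  (Extrema.min≈v⁺ (DecTotalOrder.totalOrder lexOrder) (∷-∈-rotations γ a []) (All.tabulate bound) (rot [ a ] γ refl))
  where
  bound : β ∈ rotations (γ ∷ʳ a) → a ∷ γ ≤ˡᵉˣ β
  bound β∈ with ∈-rotations⁻ β∈
  ... | u , v , eq , refl with ++-split u γ eq
  ...   | inj₁ (w , refl , refl) = subst (a ∷ u ++ w ≤ˡᵉˣ_) (sym (++-assoc w [ a ] u)) (rot (a ∷ u) w refl)
  ...   | inj₂ (b , [] , refl , refl) = rot [ a ] γ refl
  ...   | inj₂ (b , _ ∷ _ , _ , ())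

replace-differ : ∀ xs {ys} → a ≢ b → HaveRotationsDifferingInFirstPosition (xs ++ a ∷ ys) (xs ++ b ∷ ys)
replace-differ {a} {b} xs {ys} a≢b = a , b , ys ++ xs , a≢b , ∷-∈-rotations xs a ys , ∷-∈-rotations xs b ys

-- Leading zeros

Positive : String → Set
Positive = Any.Any (0 <_)

zeros : ℕ → String
zeros e = replicate e 0

zeros⊎positive : ∀ xs → (∃ λ e → xs ≡ zeros e) ⊎ Positive xs
zeros⊎positive []           = inj₁ (0 , refl)
zeros⊎positive (suc _ ∷ xs) = inj₂ (here (s≤s z≤n))
zeros⊎positive (0 ∷ xs) with zeros⊎positive xs
... | inj₁ (e , refl) = inj₁ (suc e , refl)
... | inj₂ p          = inj₂ (there p)

-- By the given inequality `γ` has at least as many leading zeros as `v`, so `0 ∷ γ` has strictly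
-- more, and the first nonzero symbol of `v` decides.
prependZero-≺ : ∀ v γ → Positive v → length v ≤ length γ →
                γ ++ E ≤ˡᵉˣ v ++ F → 0 ∷ γ ≺ v ++ D
prependZero-≺ (suc _ ∷ v) γ       _         _ _             = differ (s≤s z≤n)
prependZero-≺ (0 ∷ v)     (_ ∷ γ) (there p) l (next refl q) =
  agree (prependZero-≺ v γ p (s≤s⁻¹ l) q)

zeros-≺ : ∀ e i → i ≤ e → b < c → zeros e ++ b ∷ E ≺ zeros i ++ c ∷ F
zeros-≺ zero    zero    _   b<c = differ b<c
zeros-≺ (suc e) zero    _   b<c = differ (ℕ.≤-<-trans z≤n b<c)
zeros-≺ (suc e) (suc i) i≤e b<c = agree (zeros-≺ e i (s≤s⁻¹ i≤e) b<c)

zeros-++⁻ : ∀ e u w → zeros e ≡ u ++ w → ∃₂ λ i j → u ≡ zeros i × w ≡ zeros j × e ≡ i + j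
zeros-++⁻ e       []      w refl = 0 , e , refl , refl , refl
zeros-++⁻ (suc e) (_ ∷ u) w eq with ∷-injective eq
... | refl , eq′ with zeros-++⁻ e u w eq′
...   | i , j , refl , eq₁ , refl = suc i , j , refl , eq₁ , refl

positive-factor : ∀ xs → Positive xs → ∃₂ λ e b → ∃ λ τ → xs ≡ zeros e ++ suc b ∷ τ
positive-factor (suc b ∷ xs) _         = 0 , b , xs , refl
positive-factor (0 ∷ xs)     (there p) with positive-factor xs p
... | e , b , τ , refl = suc e , b , τ , refl

core : String → String
core []           = []
core (0 ∷ xs)     = core xs
core (suc a ∷ xs) = suc a ∷ xs

core-zeros : ∀ e xs → core (zeros e ++ xs) ≡ core xs
core-zeros zero    xs = refl
core-zeros (suc e) xs = core-zeros e xs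

length-core : ∀ xs → length (core xs) ≤ length xs
length-core []           = z≤n
length-core (0 ∷ xs)     = ℕ.m≤n⇒m≤1+n (length-core xs)
length-core (suc a ∷ xs) = ℕ.≤-refl

-- Evaluating the four operations

last-map : ∀ {A B : Set} (f : A → B) xs → last (map f xs) ≡ Maybe.map f (last xs)
last-map f []           = refl
last-map f (x ∷ [])     = refl
last-map f (x ∷ z ∷ xs) = last-map f (z ∷ xs)

last-∷ : ∀ {A : Set} {z : A} x xs → last xs ≡ just z → last (x ∷ xs) ≡ just z
last-∷ x (z ∷ xs) eq = eq

second : ∀ {A : Set} → List A → Maybe A
second xs = head (drop 1 xs)

second-map : ∀ {A B : Set} (f : A → B) xs → second (map f xs) ≡ Maybe.map f (second xs)
second-map f []           = refl
second-map f (x ∷ [])     = refl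
second-map f (x ∷ z ∷ xs) = refl

second-∷ʳ : ∀ {A : Set} {z : A} xs x → second xs ≡ just z → second (xs ∷ʳ x) ≡ just z
second-∷ʳ (_ ∷ _ ∷ xs) x eq = eq

module _ {P : Pred ℕ 0ℓ} (P? : Decidable P) (f : ℕ → ℕ) where

  findIndices-none : All (¬_ ∘ P) xs → findIndices P? xs ≡ []
  findIndices-none []                    = refl
  findIndices-none {a ∷ xs} (¬p ∷ ¬ps)
    rewrite dec-false (P? a) ¬p | findIndices-none ¬ps = refl

  update-first : ∀ xs → All (¬_ ∘ P) xs → P x →
    Maybe.map (λ i → (xs ++ x ∷ ys) [ i ]%= f) (head (findIndices P? (xs ++ x ∷ ys))) ≡ just (xs ++ f x ∷ ys)
  update-first {x} [] [] px rewrite dec-true (P? x) px = refl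
  update-first {x} {ys} (a ∷ xs) (¬p ∷ ¬ps) px rewrite dec-false (P? a) ¬p
    with findIndices P? (xs ++ x ∷ ys) | update-first {x} {ys} xs ¬ps px
  ... | i ∷ _ | eq = cong (Maybe.map (a ∷_)) eq

  -- The index is existential because its type depends on the list; what matters later is the
  -- updated list.
  last-index : ∀ xs → P x → All (¬_ ∘ P) ys →
    ∃ λ i → last (findIndices P? (xs ++ x ∷ ys)) ≡ just i × (xs ++ x ∷ ys) [ i ]%= f ≡ xs ++ f x ∷ ys
  last-index {x} [] px ¬ps rewrite dec-true (P? x) px | findIndices-none ¬ps = zero , refl , refl
  last-index {x} {ys} (a ∷ xs) px ¬ps with last-index xs px ¬ps
  ... | i , eq , upd = suc i , last≡ , cong (a ∷_) upd
    where
    indices : List (Fin (suc (length (xs ++ x ∷ ys))))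
    indices = map suc (findIndices P? (xs ++ x ∷ ys))

    tail≡ : last indices ≡ just (suc i)
    tail≡ = trans (last-map suc (findIndices P? (xs ++ x ∷ ys))) (cong (Maybe.map suc) eq)

    last≡ : last (findIndices P? (a ∷ xs ++ x ∷ ys)) ≡ just (suc i)
    last≡ with does (P? a)
    ... | true  = last-∷ zero indices tail≡
    ... | false = tail≡

  second-last-index : ∀ xs → P x → P a → ¬ P b →
    ∃ λ i → second (reverse (findIndices P? (xs ++ x ∷ a ∷ b ∷ []))) ≡ just i ×
            (xs ++ x ∷ a ∷ b ∷ []) [ i ]%= f ≡ xs ++ f x ∷ a ∷ b ∷ []
  second-last-index {x} {a} {b} [] px pa ¬pb
    rewrite dec-true (P? x) px | dec-true (P? a) pa | dec-false (P? b) ¬pb = zero , refl , refl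
  second-last-index {x} {a} {b} (c ∷ xs) px pa ¬pb with second-last-index xs px pa ¬pb
  ... | i , eq , upd = suc i , second≡ , cong (c ∷_) upd
    where
    indices : List (Fin (suc (length (xs ++ x ∷ a ∷ b ∷ []))))
    indices = map suc (findIndices P? (xs ++ x ∷ a ∷ b ∷ []))

    tail≡ : second (reverse indices) ≡ just (suc i)
    tail≡ = trans (cong second (sym (reverse-map suc (findIndices P? (xs ++ x ∷ a ∷ b ∷ [])))))
      (trans (second-map suc (reverse (findIndices P? (xs ++ x ∷ a ∷ b ∷ [])))) (cong (Maybe.map suc) eq))

    second≡ : second (reverse (findIndices P? (c ∷ xs ++ x ∷ a ∷ b ∷ []))) ≡ just (suc i)
    second≡ with does (P? c)
    ... | true  = trans (cong second (unfold-reverse zero indices)) (second-∷ʳ (reverse indices) zero tail≡)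
    ... | false = tail≡

unsnoc-∷ʳ : ∀ xs → xs ≡ ys ∷ʳ a → unsnoc xs ≡ just (ys , a)
unsnoc-∷ʳ {ys} {a} xs eq with initLast xs
unsnoc-∷ʳ {[]}    {a} .[] () | []
unsnoc-∷ʳ {_ ∷ _} {a} .[] () | []
unsnoc-∷ʳ {ys} {a} .(zs ∷ʳ z) eq | zs ∷ʳ′ z with ∷ʳ-injective zs ys eq
... | refl , refl = refl

map-just : ∀ {A B : Set} {f : A → B} {ma : Maybe A} {z w} → ma ≡ just z → f z ≡ w → Maybe.map f ma ≡ just w
map-just refl refl = refl

module _ {A : Set} {P : Pred A 0ℓ} (P? : Decidable P) {z : A} where

  find-accept : ∀ mz mzs → mz ≡ just z → P z → find P? (catMaybes (mz ∷ mzs)) ≡ just z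
  find-accept _ mzs refl pz rewrite dec-true (P? z) pz = refl

  find-reject : ∀ mz mzs → mz ≡ just z → ¬ P z → find P? (catMaybes (mz ∷ mzs)) ≡ find P? (catMaybes mzs)
  find-reject _ mzs refl ¬pz rewrite dec-false (P? z) ¬pz = refl

-- `y` is k - 2, the symbol just below the maximum `m`, and `0<y` encodes k ≥ 3.
module _ (y : ℕ) (0<y : 0 < y) where

  private
    m : ℕ
    m = suc y

    max^ : ℕ → String
    max^ t = replicate t m

  -- Incrementing the last non-maximal symbol

  max^⊀ : ∀ t → All (_≤ m) xs → ¬ max^ t ≺ xs
  max^⊀ (suc t) (b≤m ∷ _) (differ m<b) = ℕ.<⇒≱ m<b b≤m
  max^⊀ (suc t) (_ ∷ ps)  (agree q)    = max^⊀ t ps q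

  -- Follow the block `max^ t` to the first mismatch. If `w` outlasts the block, its next symbol is
  -- at most `x`, hence below `suc x`; a mismatch inside `w` is unaffected. Only a mismatch of the
  -- left `x` with an `m` of the block can be undone, namely when `suc x ≡ m`.
  raise-max-≺ : ∀ w t {T} → All (_≤ m) w → All (_≤ m) D → x < m →
    w ++ x ∷ max^ T ≺ max^ t ++ x ∷ D →
    w ++ suc x ∷ max^ T ≺ max^ t ++ suc x ∷ D ⊎
    (w ≡ max^ (length w) × length w < t × suc x ≡ m)
  raise-max-≺ []      zero    ws ds x<m (differ x<x) = contradiction refl (ℕ.<⇒≢ x<x)
  raise-max-≺ []      zero    ws ds x<m (agree p)    = contradiction p (max^⊀ _ ds)
  raise-max-≺ []      (suc t) ws ds x<m p with ℕ.m≤n⇒m<n∨m≡n x<m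
  ... | inj₁ sx<m = inj₁ (differ sx<m)
  ... | inj₂ sx≡m = inj₂ (refl , s≤s z≤n , sx≡m)
  raise-max-≺ (a ∷ w) zero    ws ds x<m p = inj₁ (differ (s≤s (≤-head (≺⇒≤ p))))
  raise-max-≺ (a ∷ w) (suc t) ws ds x<m (differ a<m) = inj₁ (differ a<m)
  raise-max-≺ (a ∷ w) (suc t) (_ ∷ ws) ds x<m (agree p) with raise-max-≺ w t ws ds x<m p
  ... | inj₁ q                = inj₁ (agree q)
  ... | inj₂ (eq , l , sx≡m)  = inj₂ (cong (m ∷_) eq , s≤s l , sx≡m)

  reverse-mid-max : ∀ w x t → reverse (w ++ x ∷ max^ t) ≡ max^ t ++ x ∷ reverse w
  reverse-mid-max w x t = trans (reverse-mid w x (max^ t)) (cong (_++ x ∷ reverse w) (reverse-replicate t m))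

  -- A cut beyond `xs` gives a reflection starting with `m` or `suc x`, above the first symbol
  -- `a ≤ x`. So a failing cut splits `xs` into `u` and `w`. A mismatch between `u` and its reversal
  -- would survive, hence `u` is a palindrome, and the remainders are compared by `raise-max-≺`.
  increment-reduced : ∀ xs t → All (_≤ m) xs → x < m → Reduced (xs ++ x ∷ max^ t) →
    Reduced (xs ++ suc x ∷ max^ t) ⊎
    (∃₂ λ P s → xs ≡ P ++ max^ s × reverse P ≡ P × s < t × suc x ≡ m)
  -- Cut after `x`, the word `x ∷ max^ t` is its own reflection.
  increment-reduced {x} [] t _ _ r =
    contradiction (subst (λ z → x ∷ max^ t ≺ x ∷ z) (reverse-replicate t m) (reflection r [ x ] (max^ t) refl)) ≺-irrefl
  increment-reduced {x} xs@(a ∷ as) t xs≤m x<m r with reduced⊎failure (s≤s z≤n) rot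
    where
    rot : ∀ u v → u ++ v ≡ xs ++ suc x ∷ max^ t → xs ++ suc x ∷ max^ t ≤ˡᵉˣ v ++ u
    rot []      v eq = ≤-reflexive (trans (sym eq) (sym (++-identityʳ v)))
    rot (b ∷ u) v eq with ++-split (b ∷ u) xs eq
    ... | inj₁ (w , eq₁ , refl) = ≺⇒≤ (subst (xs ++ _ ≺_) (sym (++-assoc w (suc x ∷ max^ t) (b ∷ u)))
      (raise-≺ xs w (subst (length w <_) (sym (trans (cong length eq₁) (length-++ (b ∷ u)))) (ℕ.m<n+m (length w) (s≤s z≤n))) (ℕ.n<1+n x)
        (subst (xs ++ _ ≤ˡᵉˣ_) (++-assoc w (x ∷ max^ t) (b ∷ u))
          (rotation r (b ∷ u) (w ++ x ∷ max^ t) (trans (sym (++-assoc (b ∷ u) w _)) (cong (_++ x ∷ max^ t) (sym eq₁)))))))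
    rot (b ∷ u) [] eq | inj₂ _ = ≤-reflexive (trans (sym eq) (++-identityʳ (b ∷ u)))
    rot (b ∷ u) (c ∷ v) eq | inj₂ (_ , w , _ , eq₂) with ∷-injective eq₂
    -- The cut lies inside the final block, so the rotation starts with `m`, while `a ≤ x < m`.
    ... | refl , eq₃ = this (subst (a <_) (sym (All.lookup {P = _≡ m} (All.replicate⁺ t refl) (subst (c ∈_) (sym eq₃) (∈-++⁺ʳ w (here refl))))) (ℕ.≤-<-trans (reduced-head a as r) x<m))
  ... | inj₁ r′ = inj₁ r′
  ... | inj₂ (u , v , eq , fail) with ++-split u xs eq
  ...   | inj₁ (w , eq₁ , refl) = shape
    where
    h : u ++ (w ++ x ∷ max^ t) ≺ reverse u ++ (max^ t ++ x ∷ reverse w)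
    h = subst₂ _≺_ (trans (cong (_++ x ∷ max^ t) eq₁) (++-assoc u w _)) (cong (reverse u ++_) (reverse-mid-max w x t))
      (reflection r u (w ++ x ∷ max^ t) (trans (sym (++-assoc u w _)) (cong (_++ x ∷ max^ t) (sym eq₁))))

    ¬h : ¬ u ++ (w ++ suc x ∷ max^ t) ≺ reverse u ++ (max^ t ++ suc x ∷ reverse w)
    ¬h p = ≺⇒≱ p (subst₂ _≤ˡᵉˣ_ (cong (reverse u ++_) (reverse-mid-max w (suc x) t)) (sym eq) fail)

    w≤m : All (_≤ m) w
    w≤m = All.++⁻ʳ u (subst (All (_≤ m)) eq₁ xs≤m)

    shape : _ ⊎ _
    shape with ≺-++⁻ (sym (length-reverse u)) h
    ... | inj₁ p = contradiction (≺-++ p) ¬h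
    ... | inj₂ (u≡ , p) with raise-max-≺ w t w≤m (All-reverse w≤m) x<m p
    ...   | inj₁ q = contradiction (subst (λ z → u ++ _ ≺ z ++ _) u≡ (≺-++ˡ u q)) ¬h
    ...   | inj₂ (w≡ , l , sx≡m) = inj₂ (u , length w , trans eq₁ (cong (u ++_) w≡) , sym u≡ , l , sx≡m)
  increment-reduced {x} xs@(a ∷ as) t xs≤m x<m r | inj₂ (u , v , eq , fail) | inj₂ (_ , w , refl , eq₂) with ∷-injective eq₂
  ...     | refl , eq₃ = contradiction fail (≺⇒≱ (subst (λ z → xs ++ suc x ∷ max^ t ≺ z ++ reverse v) (sym (reverse-mid xs (suc x) w))
    (subst (xs ++ suc x ∷ max^ t ≺_) (sym (++-assoc (reverse w) _ _))
    (<-head⇒≺ (All-reverse (All.++⁻ˡ w (subst (All (a <_)) eq₃ (All.replicate⁺ t (ℕ.≤-<-trans a≤x x<m))))) (s≤s a≤x)))))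
    where
    a≤x : a ≤ x
    a≤x = reduced-head a as r

  -- Replacing the last symbol, which is maximal, by 0

  module _ (P Z : String) (Z⁺ : All (0 <_) Z) (Z-positive : Positive Z) (r : Reduced ((P ++ Z) ∷ʳ m)) where

    suffix-positive : ∀ u c v → u ++ c ∷ v ≡ P ++ Z → Positive (c ∷ v)
    suffix-positive u c v eq with ++-split u P eq
    ... | inj₁ (w , _ , eq₁)     = subst Positive (sym eq₁) (Any.++⁺ʳ w Z-positive)
    ... | inj₂ (b , w , _ , eq₁) = here (All.head (All.++⁻ʳ (b ∷ w) (subst (All (0 <_)) eq₁ Z⁺)))

    -- The old word has a rotation starting with `(c ∷ v) ∷ʳ m`, the new one starts with `c ∷ v`.
    -- This common part contains a nonzero symbol, so `prependZero-≺` transfers the bound.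
    prependZero-rotation : ∀ u v → u ++ v ≡ 0 ∷ P ++ Z → 0 ∷ P ++ Z ≤ˡᵉˣ v ++ u
    prependZero-rotation []      v       eq = ≤-reflexive (trans (sym eq) (sym (++-identityʳ v)))
    prependZero-rotation (b ∷ u) []      eq = ≤-reflexive (trans (sym eq) (++-identityʳ (b ∷ u)))
    prependZero-rotation (b ∷ u) (c ∷ v) eq with ∷-injective eq
    ... | refl , eq′ = ≺⇒≤ (prependZero-≺ (c ∷ v) (P ++ Z) (suffix-positive u c v eq′)
      (subst (length (c ∷ v) ≤_) (trans (sym (length-++ u)) (cong length eq′)) (ℕ.m≤n+m _ (length u)))
      (subst ((P ++ Z) ∷ʳ m ≤ˡᵉˣ_) (++-assoc (c ∷ v) [ m ] u)
        (rotation r u ((c ∷ v) ∷ʳ m) (trans (sym (++-assoc u (c ∷ v) [ m ])) (cong (_∷ʳ m) eq′)))))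

    prependZero-reflection : ∀ u v → u ++ v ≡ P ++ Z → Positive u → 0 ∷ P ++ Z ≺ reverse u ++ D
    prependZero-reflection u v eq u⁺ = prependZero-≺ (reverse u) (P ++ Z) (Any.reverse⁺ u⁺)
      (subst₂ _≤_ (sym (length-reverse u)) (trans (sym (length-++ u)) (cong length eq)) (ℕ.m≤m+n (length u) (length v)))
      (≺⇒≤ (reflection r u (v ∷ʳ m) (trans (sym (++-assoc u v [ m ])) (cong (_∷ʳ m) eq))))

    -- A failing prefix has no nonzero symbol, by `prependZero-reflection`. As `Z` contains no zero,
    -- that prefix ends within `0 ∷ P`, and cancelling its zeros on both sides leaves `P₁ ++ Z`
    -- against its reversal.
    prependZero-reduced :
      Reduced (0 ∷ P ++ Z) ⊎
      (∃₂ λ e P₁ → P ≡ zeros e ++ P₁ × reverse (P₁ ++ Z) ≤ˡᵉˣ P₁ ++ Z)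
    prependZero-reduced with reduced⊎failure (s≤s z≤n) prependZero-rotation
    ... | inj₁ r′ = inj₁ r′
    -- The empty prefix reverses the whole word; this puts the new zero last, behind the reversal of
    -- `P ++ Z`.
    ... | inj₂ ([] , v , refl , fail) = contradiction
      (subst (_≤ˡᵉˣ 0 ∷ P ++ Z) (unfold-reverse 0 (P ++ Z)) fail)
      (≺⇒≱ (prependZero-reflection (P ++ Z) [] (++-identityʳ _) (Any.++⁺ʳ P Z-positive)))
    ... | inj₂ (b ∷ u , v , eq , fail) with ∷-injective eq | zeros⊎positive u
    ...   | refl , eq′ | inj₂ u⁺ = contradiction
      (subst (_≤ˡᵉˣ 0 ∷ P ++ Z) (trans (cong (_++ reverse v) (unfold-reverse 0 u)) (++-assoc (reverse u) [ 0 ] (reverse v))) fail)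
      (≺⇒≱ (prependZero-reflection u v eq′ u⁺))
    ...   | refl , eq′ | inj₁ (e , refl) with ++-split (zeros e) P eq′
    ...     | inj₂ (b , w , eq₁ , eq₂) = contradiction
      (subst (0 <_) (All.head (All.++⁻ʳ P (subst (All (_≡ 0)) eq₁ (All.replicate⁺ e refl)))) (All.head (subst (All (0 <_)) eq₂ Z⁺))) ℕ.n≮0
    ...     | inj₁ (P₁ , eq₁ , refl) = inj₂ (e , P₁ , eq₁ ,
      ≤-++ˡ⁻ (zeros (suc e)) (subst₂ _≤ˡᵉˣ_ (cong (_++ reverse (P₁ ++ Z)) (reverse-replicate (suc e) 0)) (sym eq) fail))

  -- Decrementing the first nonzero symbol

  -- Either `v` has fewer than `e` leading zeros, or its first nonzero symbol faces the old `m`, is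
  -- at least `m`, and so exceeds `y`.
  decrement-≺ : ∀ e v → Positive v → zeros e ++ m ∷ E ≤ˡᵉˣ v ++ F → zeros e ++ y ∷ D ≺ v ++ zs
  decrement-≺ zero    (b ∷ v)     _         p             = differ (≤-head p)
  decrement-≺ (suc e) (suc _ ∷ v) _         _             = differ (s≤s z≤n)
  decrement-≺ (suc e) (0 ∷ v)     (there q) (next _ p)    = agree (decrement-≺ e v q p)

  -- Cuts among the zeros are settled by counting zeros. Past the lowered symbol, a rotation
  -- contains the final `m`, and a reflection contains `c`, before it reaches the lowered symbol
  -- again; this supplies the nonzero symbol that `decrement-≺` asks for.
  decrement-reduced : ∀ e c τ σ → 0 < c → c ∷ τ ≡ σ ∷ʳ m →
    Reduced (zeros (suc e) ++ m ∷ c ∷ τ) → Reduced (zeros (suc e) ++ y ∷ c ∷ τ)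
  decrement-reduced e c τ σ 0<c eqσ r = record { rotation = rot ; reflection = ref }
    where
    0ᵉ : String
    0ᵉ = zeros (suc e)

    rot : ∀ u v → u ++ v ≡ 0ᵉ ++ y ∷ c ∷ τ → 0ᵉ ++ y ∷ c ∷ τ ≤ˡᵉˣ v ++ u
    rot []      v eq = ≤-reflexive (trans (sym eq) (sym (++-identityʳ v)))
    rot (b ∷ u) v eq with ++-split (b ∷ u) 0ᵉ eq
    ... | inj₁ (w , eq₁ , refl) with zeros-++⁻ (suc e) (b ∷ u) w eq₁
    ...   | suc i , j , _ , refl , eq₂ = ≺⇒≤ (subst₂ _≺_ (replicate-∷ e 0 _) (sym (++-assoc (zeros j) _ (b ∷ u)))
      (zeros-≺ e j (subst (j ≤_) (sym (ℕ.suc-injective eq₂)) (ℕ.m≤n+m j i)) 0<y))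
    rot (b ∷ u) []       eq | inj₂ _ = ≤-reflexive (trans (sym eq) (++-identityʳ (b ∷ u)))
    rot (b ∷ u) (d ∷ v)  eq | inj₂ (_ , w , eq₁ , eq₂) with ∷-injective eq₂
    ... | refl , eq₃ = ≺⇒≤ (decrement-≺ (suc e) (d ∷ v) suffix⁺
      (rotation r (0ᵉ ++ m ∷ w) (d ∷ v) (trans (++-assoc 0ᵉ (m ∷ w) (d ∷ v)) (cong (λ z → 0ᵉ ++ m ∷ z) (sym eq₃)))))
      where
      suffix⁺ : Positive (d ∷ v)
      suffix⁺ with ++-split w σ (trans (sym eq₃) eqσ)
      ... | inj₁ (z , _ , eq₄) = subst Positive (sym eq₄) (Any.++⁺ʳ z (here (s≤s z≤n)))
      ... | inj₂ (_ , [] , _ , ())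
      ... | inj₂ (_ , _ ∷ _ , _ , ())

    ref : ∀ u v → u ++ v ≡ 0ᵉ ++ y ∷ c ∷ τ → 0ᵉ ++ y ∷ c ∷ τ ≺ reverse u ++ reverse v
    ref u v eq with ++-split u 0ᵉ eq
    ... | inj₁ (w , eq₁ , refl) with zeros-++⁻ (suc e) u w eq₁
    ...   | i , j , refl , _ , eq₂ = subst (_ ≺_)
      (cong₂ _++_ (sym (reverse-replicate i 0)) (begin
        m ∷ reverse σ ++ y ∷ reverse w         ≡⟨ cong (_++ y ∷ reverse w) (reverse-mid σ m []) ⟨
        reverse (σ ∷ʳ m) ++ y ∷ reverse w      ≡⟨ cong (λ z → reverse z ++ y ∷ reverse w) eqσ ⟨
        reverse (c ∷ τ) ++ y ∷ reverse w       ≡⟨ reverse-mid w y (c ∷ τ) ⟨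
        reverse (w ++ y ∷ c ∷ τ)               ∎))
      (zeros-≺ (suc e) i (subst (i ≤_) (sym eq₂) (ℕ.m≤m+n i j)) (ℕ.n<1+n y))
      where open ≡-Reasoning
    ref u v eq | inj₂ (_ , w , eq₁ , eq₂) with ∷-injective eq₂
    ... | refl , eq₃ = subst (λ z → 0ᵉ ++ y ∷ c ∷ τ ≺ z ++ reverse v) (sym (trans (cong reverse eq₁) (reverse-mid 0ᵉ y w)))
        (subst (_ ≺_) (sym (++-assoc (reverse w) _ _)) (bound w eq₃))
      where
      bound : ∀ w → c ∷ τ ≡ w ++ v → 0ᵉ ++ y ∷ c ∷ τ ≺ reverse w ++ y ∷ reverse 0ᵉ ++ reverse v
      bound []      _  = differ 0<y
      bound (d ∷ w) eq with ∷-injective eq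
      ... | refl , refl = decrement-≺ (suc e) (reverse (d ∷ w)) (Any.reverse⁺ {xs = d ∷ w} (here 0<c))
        (≺⇒≤ (subst (0ᵉ ++ m ∷ d ∷ w ++ v ≺_) (trans (cong (_++ reverse v) (reverse-mid 0ᵉ m (d ∷ w))) (++-assoc (reverse (d ∷ w)) _ _))
          (reflection r (0ᵉ ++ m ∷ d ∷ w) v (++-assoc 0ᵉ (m ∷ d ∷ w) v))))

  -- Incrementing the second-last non-maximal symbol

  -- The critical reflections compare `w ++ 1 ∷ y ∷ m ∷ []` with `m ∷ y ∷ 1 ∷ reverse w`. For `w`
  -- equal to `[ m ]` and `y ≡ 1` these words coincide, which is why the symbol before the raised
  -- zero must be below `m`.
  incrementSecondLast-reduced : ∀ xs → (∀ u c → 0 ∷ xs ≡ u ∷ʳ c → c < m) →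
    Reduced (0 ∷ xs ++ 0 ∷ y ∷ m ∷ []) → Reduced (0 ∷ xs ++ 1 ∷ y ∷ m ∷ [])
  incrementSecondLast-reduced xs last<m r = record { rotation = rot ; reflection = ref }
    where
    ends⁺ : All (0 <_) (y ∷ m ∷ [])
    ends⁺ = 0<y ∷ s≤s z≤n ∷ []

    rot : ∀ u v → u ++ v ≡ 0 ∷ xs ++ 1 ∷ y ∷ m ∷ [] → 0 ∷ xs ++ 1 ∷ y ∷ m ∷ [] ≤ˡᵉˣ v ++ u
    rot []      v eq = ≤-reflexive (trans (sym eq) (sym (++-identityʳ v)))
    rot (b ∷ u) v eq with ++-split (b ∷ u) (0 ∷ xs) eq
    ... | inj₁ (w , eq₁ , refl) = ≺⇒≤ (subst (_ ≺_) (sym (++-assoc w _ (b ∷ u)))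
      (raise-≺ (0 ∷ xs) w (subst (length w <_) (sym (trans (cong length eq₁) (length-++ (b ∷ u)))) (ℕ.m<n+m (length w) (s≤s z≤n))) (ℕ.n<1+n 0)
        (subst (_ ≤ˡᵉˣ_) (++-assoc w _ (b ∷ u))
          (rotation r (b ∷ u) (w ++ 0 ∷ y ∷ m ∷ []) (trans (sym (++-assoc (b ∷ u) w _)) (cong (_++ 0 ∷ y ∷ m ∷ []) (sym eq₁)))))))
    rot (b ∷ u) []      eq | inj₂ _ = ≤-reflexive (trans (sym eq) (++-identityʳ (b ∷ u)))
    rot (b ∷ u) (c ∷ v) eq | inj₂ (_ , w , _ , eq₂) with ∷-injective eq₂
    ... | refl , eq₃ = this (All.head (All.++⁻ʳ w (subst (All (0 <_)) eq₃ ends⁺)))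

    ref : ∀ u v → u ++ v ≡ 0 ∷ xs ++ 1 ∷ y ∷ m ∷ [] → 0 ∷ xs ++ 1 ∷ y ∷ m ∷ [] ≺ reverse u ++ reverse v
    ref u v eq with ++-split u (0 ∷ xs) eq
    ... | inj₁ (w , eq₁ , refl) = subst₂ _≺_ (trans (sym (++-assoc u w _)) (cong (_++ 1 ∷ y ∷ m ∷ []) (sym eq₁)))
        (cong (reverse u ++_) (sym (reverse-mid w 1 (y ∷ m ∷ [])))) goal
      where
      h : u ++ (w ++ 0 ∷ y ∷ m ∷ []) ≺ reverse u ++ (m ∷ y ∷ 0 ∷ reverse w)
      h = subst₂ _≺_ (trans (cong (_++ 0 ∷ y ∷ m ∷ []) eq₁) (++-assoc u w _)) (cong (reverse u ++_) (reverse-mid w 0 (y ∷ m ∷ [])))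
        (reflection r u (w ++ 0 ∷ y ∷ m ∷ []) (trans (sym (++-assoc u w _)) (cong (_++ 0 ∷ y ∷ m ∷ []) (sym eq₁))))

      bound : ∀ w → 0 ∷ xs ≡ u ++ w → w ++ 0 ∷ y ∷ m ∷ [] ≺ m ∷ y ∷ 0 ∷ reverse w → w ++ 1 ∷ y ∷ m ∷ [] ≺ m ∷ y ∷ 1 ∷ reverse w
      -- Here `1 < m` is needed, which is `0<y`.
      bound []               _  _ = differ (s≤s 0<y)
      bound (c ∷ [])         eq _ = differ (last<m u c eq)
      bound (c ∷ d ∷ [])     _  (differ c<m)         = differ c<m
      bound (c ∷ d ∷ [])     _  (agree (differ d<y)) = agree (differ d<y)
      bound (c ∷ d ∷ [])     _  (agree (agree p))    = contradiction p ≺-irrefl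
      -- Once `w` has three symbols, the raised symbol on the right, at position two, faces an
      -- unchanged one.
      bound (c ∷ d ∷ f ∷ w)  _  p = raise-≺ (c ∷ d ∷ f ∷ w) (m ∷ y ∷ []) (s≤s (s≤s (s≤s z≤n))) (ℕ.n<1+n 0) (≺⇒≤ p)

      goal : u ++ (w ++ 1 ∷ y ∷ m ∷ []) ≺ reverse u ++ (m ∷ y ∷ 1 ∷ reverse w)
      goal with ≺-++⁻ (sym (length-reverse u)) h
      ... | inj₁ p        = ≺-++ p
      ... | inj₂ (u≡ , p) = subst (λ z → u ++ _ ≺ z ++ _) u≡ (≺-++ˡ u (bound w eq₁ p))
    ... | inj₂ (_ , w , eq₁ , eq₂) with ∷-injective eq₂
    ...   | refl , eq₃ = subst (λ z → _ ≺ z ++ reverse v) (sym (trans (cong reverse eq₁) (reverse-mid (0 ∷ xs) 1 w)))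
      (subst (_ ≺_) (sym (++-assoc (reverse w) _ _))
        (<-head⇒≺ (All-reverse (All.++⁻ˡ w (subst (All (0 <_)) eq₃ ends⁺))) (ℕ.n<1+n 0)))

  -- Bracelets for which neither of the first two operations works

  -- The lower bound will come from the failing reversal, the upper one from `rotation-at-zeros`;
  -- together they force the first `t` symbols of `V` to be `m`, while the upper bound allows at
  -- most `s` of them.
  squeeze-max : ∀ s t V → max^ t ++ D ≤ˡᵉˣ V → V ++ E ≤ˡᵉˣ max^ s ++ y ∷ F → t ≤ s
  squeeze-max s       zero    V       p q = z≤n
  squeeze-max zero    (suc t) (b ∷ V) p q = contradiction (ℕ.≤-trans (≤-head p) (≤-head q)) (ℕ.<⇒≱ (ℕ.n<1+n y))
  squeeze-max (suc s) (suc t) (b ∷ V) p q with ≤-tail (≤-head p) q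
  ... | refl , q′ = s≤s (squeeze-max s t V (proj₂ (≤-tail ℕ.≤-refl p)) q′)

  max^-dominated : ∀ s V → All (_≤ m) V → max^ (suc s) ++ y ∷ D ≤ˡᵉˣ V →
    ∃₂ λ c V′ → V ≡ m ∷ c ∷ V′ × 0 < c
  max^-dominated s (b ∷ V) (b≤m ∷ _) p with ≤-tail b≤m p
  max^-dominated zero    (b ∷ [])    _ p | refl , ()
  max^-dominated (suc s) (b ∷ [])    _ p | refl , ()
  max^-dominated zero    (b ∷ c ∷ V) _ p | refl , q = c , V , refl , ℕ.<-≤-trans 0<y (≤-head q)
  max^-dominated (suc s) (b ∷ c ∷ V) _ p | refl , q = c , V , refl , ℕ.<-≤-trans (s≤s z≤n) (≤-head q)

  plateau : ℕ → ℕ → String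
  plateau s t = max^ s ++ y ∷ max^ t

  plateau⁺ : ∀ s t → All (0 <_) (plateau s t)
  plateau⁺ s t = All.++⁺ (All.replicate⁺ s (s≤s z≤n)) (0<y ∷ All.replicate⁺ t (s≤s z≤n))

  plateau-positive : ∀ s t → Positive (plateau s t)
  plateau-positive s t = Any.++⁺ʳ (max^ s) (here 0<y)

  NonMax : String → Set
  NonMax = Any.Any (_≢ m)

  -- The first nonzero symbol `b` and `NonMax τ` are recorded for both alternatives: FirstNonMin may
  -- succeed even where only SecondLastNonMax is guaranteed, and that step must decrease the rank
  -- too.
  data Descent (α : String) : Set where
    descent : ∀ e b τ → α ≡ zeros e ++ b ∷ τ → 0 < b → NonMax τ →
      Reduced (zeros e ++ pred b ∷ τ) ⊎
      (∃ λ xs → α ≡ xs ++ 0 ∷ y ∷ m ∷ [] × Positive xs × Reduced (xs ++ 1 ∷ y ∷ m ∷ [])) →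
      Descent α

  module _ (P : String) (palindrome : reverse P ≡ P) (P≤m : All (_≤ m) P)
           (e : ℕ) (P₁ : String) (P≡ : P ≡ zeros e ++ P₁) where

    private
      P≡′ : P ≡ reverse P₁ ++ zeros e
      P≡′ = begin
        P                                   ≡⟨ palindrome ⟨
        reverse P                           ≡⟨ cong reverse P≡ ⟩
        reverse (zeros e ++ P₁)             ≡⟨ reverse-++ (zeros e) P₁ ⟩
        reverse P₁ ++ reverse (zeros e)     ≡⟨ cong (reverse P₁ ++_) (reverse-replicate e 0) ⟩
        reverse P₁ ++ zeros e               ∎
        where open ≡-Reasoning

      word≡ : ∀ Z → (P ++ Z) ∷ʳ m ≡ zeros e ++ (P₁ ++ Z) ∷ʳ m
      word≡ Z = begin
        (P ++ Z) ∷ʳ m                   ≡⟨ cong (λ z → (z ++ Z) ∷ʳ m) P≡ ⟩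
        ((zeros e ++ P₁) ++ Z) ∷ʳ m     ≡⟨ cong (_∷ʳ m) (++-assoc (zeros e) P₁ Z) ⟩
        (zeros e ++ P₁ ++ Z) ∷ʳ m       ≡⟨ ++-assoc (zeros e) (P₁ ++ Z) [ m ] ⟩
        zeros e ++ (P₁ ++ Z) ∷ʳ m       ∎
        where open ≡-Reasoning

      P₁≤m : All (_≤ m) P₁
      P₁≤m = All.++⁻ʳ (zeros e) (subst (All (_≤ m)) P≡ P≤m)

    -- The palindrome `P` ends in the same `e` zeros it starts with. Rotate to those and cancel them
    -- against the leading ones.
    rotation-at-zeros : ∀ Z → Reduced ((P ++ Z) ∷ʳ m) → (P₁ ++ Z) ∷ʳ m ≤ˡᵉˣ (Z ∷ʳ m) ++ reverse P₁
    rotation-at-zeros Z r = ≤-++ˡ⁻ (zeros e) (subst₂ _≤ˡᵉˣ_ (word≡ Z) (++-assoc (zeros e) (Z ∷ʳ m) (reverse P₁))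
      (rotation r (reverse P₁) (zeros e ++ Z ∷ʳ m) (begin
        reverse P₁ ++ zeros e ++ Z ∷ʳ m     ≡⟨ ++-assoc (reverse P₁) (zeros e) (Z ∷ʳ m) ⟨
        (reverse P₁ ++ zeros e) ++ Z ∷ʳ m   ≡⟨ cong (_++ Z ∷ʳ m) P≡′ ⟨
        P ++ Z ∷ʳ m                         ≡⟨ ++-assoc P Z [ m ] ⟨
        (P ++ Z) ∷ʳ m                       ∎)))
      where open ≡-Reasoning

    reverse-plateau : ∀ s t → reverse (P₁ ++ plateau s t) ≡ max^ t ++ y ∷ max^ s ++ reverse P₁
    reverse-plateau s t = begin
      reverse (P₁ ++ plateau s t)                   ≡⟨ reverse-++ P₁ (plateau s t) ⟩
      reverse (plateau s t) ++ reverse P₁           ≡⟨ cong (_++ reverse P₁) (reverse-mid-max (max^ s) y t) ⟩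
      (max^ t ++ y ∷ reverse (max^ s)) ++ reverse P₁ ≡⟨ cong (λ z → (max^ t ++ y ∷ z) ++ reverse P₁) (reverse-replicate s m) ⟩
      (max^ t ++ y ∷ max^ s) ++ reverse P₁          ≡⟨ ++-assoc (max^ t) (y ∷ max^ s) (reverse P₁) ⟩
      max^ t ++ y ∷ max^ s ++ reverse P₁            ∎
      where open ≡-Reasoning

    -- The failing reversal starts with `max^ (suc s) ++ y ∷ …`, so it forces
    -- `P₁ ++ plateau (suc s) (suc s)` to start with `m` and then a nonzero symbol, as
    -- `decrement-reduced` requires.
    wide-descent : ∀ s → Reduced ((P ++ plateau (suc s) (suc s)) ∷ʳ m) →
      reverse (P₁ ++ plateau (suc s) (suc s)) ≤ˡᵉˣ P₁ ++ plateau (suc s) (suc s) →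
      Descent ((P ++ plateau (suc s) (suc s)) ∷ʳ m)
    wide-descent s r fail
      with max^-dominated s (P₁ ++ Z) (All.++⁺ P₁≤m Z≤m) (subst (_≤ˡᵉˣ P₁ ++ Z) (reverse-plateau (suc s) (suc s)) fail)
      where
      Z : String
      Z = plateau (suc s) (suc s)
      Z≤m : All (_≤ m) Z
      Z≤m = All.++⁺ (All.replicate⁺ (suc s) ℕ.≤-refl) (ℕ.n≤1+n y ∷ All.replicate⁺ (suc s) ℕ.≤-refl)
    ... | c , V , V≡ , 0<c = descend e shape
      where
      ω : String
      ω = (P ++ plateau (suc s) (suc s)) ∷ʳ m

      shape : ω ≡ zeros e ++ m ∷ c ∷ V ∷ʳ m
      shape = trans (word≡ _) (cong (λ z → zeros e ++ z ∷ʳ m) V≡)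

      nonMax : NonMax (c ∷ V ∷ʳ m)
      nonMax with subst (y ∈_) V≡ (∈-++⁺ʳ P₁ (∈-++⁺ʳ (max^ (suc s)) (here refl)))
      ... | here y≡m = contradiction y≡m (ℕ.<⇒≢ (ℕ.n<1+n y))
      ... | there p  = Any.++⁺ˡ (Any.map (λ { refl → ℕ.<⇒≢ (ℕ.n<1+n y) }) p)

      descend : ∀ e → ω ≡ zeros e ++ m ∷ c ∷ V ∷ʳ m → Descent ω
      -- Without a leading zero the word would start with `m`, above its rotation starting with `y`.
      descend zero eq = contradiction
        (≤-head (subst (_≤ˡᵉˣ y ∷ (max^ (suc s) ∷ʳ m) ++ P ++ max^ (suc s)) eq
          (rotation r (P ++ max^ (suc s)) (y ∷ max^ (suc s) ∷ʳ m) (begin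
            (P ++ max^ (suc s)) ++ y ∷ max^ (suc s) ∷ʳ m    ≡⟨ ++-assoc (P ++ max^ (suc s)) (y ∷ max^ (suc s)) [ m ] ⟨
            ((P ++ max^ (suc s)) ++ y ∷ max^ (suc s)) ∷ʳ m  ≡⟨ cong (_∷ʳ m) (++-assoc P (max^ (suc s)) (y ∷ max^ (suc s))) ⟩
            ω                                               ∎))))
        (ℕ.<⇒≱ (ℕ.n<1+n y))
        where open ≡-Reasoning
      descend (suc e) eq = descent (suc e) m (c ∷ V ∷ʳ m) eq (s≤s z≤n) nonMax
        (inj₁ (decrement-reduced e c (V ∷ʳ m) (c ∷ V) 0<c refl (subst Reduced eq r)))

  -- If `P₁` starts with `p`, the failing reversal gives `y ≤ p` and `rotation-at-zeros` gives
  -- `p ≤ y`. By palindromy the symbol before the last zero of `P` is then 0 or `p`, hence below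
  -- `m`, and that last zero can be raised.
  narrow-descent : ∀ P e P₁ → reverse P ≡ P → P ≡ zeros e ++ P₁ → All (_≤ m) P →
    Reduced ((P ∷ʳ y) ∷ʳ m) → reverse (P₁ ∷ʳ y) ≤ˡᵉˣ P₁ ∷ʳ y →
    (∃ λ e → (P ∷ʳ y) ∷ʳ m ≡ zeros e ++ y ∷ m ∷ []) ⊎ Descent ((P ∷ʳ y) ∷ʳ m)
  -- With no zeros removed, `fail` contradicts the reflection cut just before the final `m`.
  narrow-descent P zero P₁ pal refl P≤m r fail with ≺-++⁻ (sym (length-reverse (P ∷ʳ y))) (reflection r (P ∷ʳ y) [ m ] refl)
  ... | inj₁ p       = contradiction fail (≺⇒≱ p)
  ... | inj₂ (_ , p) = contradiction p ≺-irrefl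
  narrow-descent P (suc e) [] pal refl P≤m r fail = inj₁ (suc e , (begin
    ((zeros (suc e) ++ []) ∷ʳ y) ∷ʳ m  ≡⟨ cong (λ z → (z ∷ʳ y) ∷ʳ m) (++-identityʳ (zeros (suc e))) ⟩
    (zeros (suc e) ∷ʳ y) ∷ʳ m          ≡⟨ ++-assoc (zeros (suc e)) [ y ] [ m ] ⟩
    zeros (suc e) ++ y ∷ m ∷ []        ∎))
    where open ≡-Reasoning
  narrow-descent P (suc e) (p ∷ W) pal P≡ P≤m r fail = inj₂
    (descent (suc e) p (W ++ y ∷ m ∷ []) ω≡ (ℕ.<-≤-trans 0<y y≤p) (Any.++⁺ʳ W (here (ℕ.<⇒≢ (ℕ.n<1+n y))))
      (inj₂ (ξ , ω≡′ , ξ⁺ , incremented ξ ξ⁺ refl)))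
    where
    open ≡-Reasoning
    ω : String
    ω = (P ∷ʳ y) ∷ʳ m

    ξ : String
    ξ = reverse (zeros e ++ p ∷ W)

    y≤p : y ≤ p
    y≤p = ≤-head (subst (_≤ˡᵉˣ p ∷ W ∷ʳ y) (reverse-mid (p ∷ W) y []) fail)

    p≤y : p ≤ y
    p≤y = ≤-head (rotation-at-zeros P pal P≤m (suc e) (p ∷ W) P≡ [ y ] r)

    P≡′ : P ≡ ξ ∷ʳ 0
    P≡′ = trans (sym pal) (trans (cong reverse P≡) (unfold-reverse 0 (zeros e ++ p ∷ W)))

    ω≡ : ω ≡ zeros (suc e) ++ p ∷ W ++ y ∷ m ∷ []
    ω≡ = begin
      (P ∷ʳ y) ∷ʳ m                                  ≡⟨ ++-assoc P [ y ] [ m ] ⟩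
      P ++ y ∷ m ∷ []                                ≡⟨ cong (_++ y ∷ m ∷ []) P≡ ⟩
      (zeros (suc e) ++ p ∷ W) ++ y ∷ m ∷ []         ≡⟨ ++-assoc (zeros (suc e)) (p ∷ W) _ ⟩
      zeros (suc e) ++ p ∷ W ++ y ∷ m ∷ []           ∎

    ω≡′ : ω ≡ ξ ++ 0 ∷ y ∷ m ∷ []
    ω≡′ = begin
      (P ∷ʳ y) ∷ʳ m                   ≡⟨ ++-assoc P [ y ] [ m ] ⟩
      P ++ y ∷ m ∷ []                 ≡⟨ cong (_++ y ∷ m ∷ []) P≡′ ⟩
      (ξ ∷ʳ 0) ++ y ∷ m ∷ []         ≡⟨ ++-assoc ξ [ 0 ] _ ⟩
      ξ ++ 0 ∷ y ∷ m ∷ []            ∎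

    ξ⁺ : Positive ξ
    ξ⁺ = Any.reverse⁺ (Any.++⁺ʳ (zeros e) (here (ℕ.<-≤-trans 0<y y≤p)))

    head<m : ∀ e c u → c ∷ u ≡ zeros e ++ p ∷ W → c < m
    head<m zero    c u refl = s≤s p≤y
    head<m (suc e) c u refl = s≤s z≤n

    last<m : ∀ u c → ξ ≡ u ∷ʳ c → c < m
    last<m u c eq = head<m e c (reverse u) (begin
      c ∷ reverse u          ≡⟨ reverse-mid u c [] ⟨
      reverse (u ∷ʳ c)       ≡⟨ cong reverse eq ⟨
      reverse ξ             ≡⟨ reverse-involutive (zeros e ++ p ∷ W) ⟩
      zeros e ++ p ∷ W       ∎)

    incremented : ∀ zs → Positive zs → ξ ≡ zs → Reduced (ξ ++ 1 ∷ y ∷ m ∷ [])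
    -- Positivity makes `ξ` nonempty, and its head is the leading zero of `P`.
    incremented (z ∷ zs) _ eq with ∷-injective (trans (cong (_∷ʳ 0) (sym eq)) (trans (sym P≡′) P≡))
    ... | refl , _ = subst (λ ξ → Reduced (ξ ++ 1 ∷ y ∷ m ∷ [])) (sym eq)
      (incrementSecondLast-reduced zs (λ u c eq′ → last<m u c (trans eq eq′))
        (subst (λ ξ → Reduced (ξ ++ 0 ∷ y ∷ m ∷ [])) eq (subst Reduced ω≡′ r)))

  -- Termination

  -- The value 0 covers LastNonMax on 0ᵉ b mᵗ, the one case where an increment
  -- hits the first nonzero symbol.
  lead : String → ℕ
  lead []      = 0
  lead (b ∷ τ) = if does (All.all? (ℕ._≟ m) τ) then 0 else b

  deficit : String → ℕ
  deficit xs = sum (map (m ∸_) xs)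

  rank : String → ℕ × ℕ × ℕ
  rank xs = length (core xs) , lead (core xs) , deficit xs

  infix 4 _⊏_

  _⊏_ : Rel String 0ℓ
  _⊏_ = ×-Lex _≡_ _<_ (×-Lex _≡_ _<_ _<_) on rank

  ⊏-wellFounded : WellFounded _⊏_
  ⊏-wellFounded = On.wellFounded rank (×-wellFounded <-wellFounded (×-wellFounded <-wellFounded <-wellFounded))

  length-core-∷ʳ : ∀ xs → length (core xs) < length (core (xs ∷ʳ m))
  length-core-∷ʳ []           = s≤s z≤n
  length-core-∷ʳ (0 ∷ xs)     = length-core-∷ʳ xs
  length-core-∷ʳ (suc a ∷ xs) = s≤s (subst (length xs <_) (sym (length-++ xs)) (ℕ.m<m+n (length xs) (s≤s z≤n)))

  lead-nonMax : ∀ b τ → NonMax τ → lead (b ∷ τ) ≡ b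
  lead-nonMax b τ τ-nonMax rewrite dec-false (All.all? (ℕ._≟ m) τ) (λ all → All.All¬⇒¬Any (All.map (λ eq neq → neq eq) all) τ-nonMax) = refl

  lead-max^ : ∀ b t → lead (b ∷ max^ t) ≡ 0
  lead-max^ b t rewrite dec-true (All.all? (ℕ._≟ m) (max^ t)) (All.replicate⁺ t refl) = refl

  lead-≤ : ∀ b τ → lead (b ∷ τ) ≤ b
  lead-≤ b τ with does (All.all? (ℕ._≟ m) τ)
  ... | true  = z≤n
  ... | false = ℕ.≤-refl

  deficit-< : ∀ xs → x < m → deficit (xs ++ suc x ∷ ys) < deficit (xs ++ x ∷ ys)
  deficit-< {x} {ys} []       x<m = ℕ.+-monoˡ-< (deficit ys) (ℕ.∸-monoʳ-< (ℕ.n<1+n x) x<m)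
  deficit-<          (a ∷ xs) x<m = ℕ.+-monoʳ-< (m ∸ a) (deficit-< xs x<m)

  -- The first nonzero symbol lies in `xs` and stays. Before the step `x` differs from `m`, so
  -- `lead` is that symbol; afterwards `lead` either drops to 0 or is unchanged, and then `deficit`
  -- drops.
  increment-⊏ : ∀ xs {x ys} → Positive xs → x < m → xs ++ suc x ∷ ys ⊏ xs ++ x ∷ ys
  increment-⊏ xs {x} {ys} xs⁺ x<m with positive-factor xs xs⁺
  ... | e , b , τ , refl
    rewrite ++-assoc (zeros e) (suc b ∷ τ) (suc x ∷ ys) | ++-assoc (zeros e) (suc b ∷ τ) (x ∷ ys)
          | core-zeros e (suc b ∷ τ ++ suc x ∷ ys) | core-zeros e (suc b ∷ τ ++ x ∷ ys)
          | lead-nonMax (suc b) (τ ++ x ∷ ys) (Any.++⁺ʳ τ (here (ℕ.<⇒≢ x<m)))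
    = inj₂ (cong suc (length-replace τ) , by-lead (ℕ.m≤n⇒m<n∨m≡n (lead-≤ (suc b) (τ ++ suc x ∷ ys))))
    where
    by-lead : lead (suc b ∷ τ ++ suc x ∷ ys) < suc b ⊎ lead (suc b ∷ τ ++ suc x ∷ ys) ≡ suc b → _
    by-lead (inj₁ p) = inj₁ p
    by-lead (inj₂ p) = inj₂ (p , subst₂ (λ ξ ζ → deficit ξ < deficit ζ)
      (++-assoc (zeros e) (suc b ∷ τ) (suc x ∷ ys)) (++-assoc (zeros e) (suc b ∷ τ) (x ∷ ys)) (deficit-< (zeros e ++ suc b ∷ τ) x<m))

  incrementLast-⊏ : ∀ xs t → x < m → Reduced (xs ++ x ∷ max^ t) → xs ++ suc x ∷ max^ t ⊏ xs ++ x ∷ max^ t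
  incrementLast-⊏ {x} xs t x<m r with zeros⊎positive xs
  ... | inj₂ xs⁺ = increment-⊏ xs xs⁺ x<m
  -- The word would be a block of zeros followed by `max^ t`, which is symmetric.
  incrementLast-⊏ {zero} xs t x<m r | inj₁ (e , refl) = contradiction
    (subst (zeros e ++ 0 ∷ max^ t ≺_)
      (trans (cong₂ _++_ (reverse-replicate (suc e) 0) (reverse-replicate t m)) (sym (replicate-∷ e 0 (max^ t))))
      (reflection r (zeros (suc e)) (max^ t) (sym (replicate-∷ e 0 (max^ t)))))
    ≺-irrefl
  incrementLast-⊏ {suc x} xs t x<m r | inj₁ (e , refl)
    rewrite core-zeros e (suc (suc x) ∷ max^ t) | core-zeros e (suc x ∷ max^ t)
          | lead-max^ (suc (suc x)) t | lead-max^ (suc x) t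
    = inj₂ (refl , inj₂ (refl , deficit-< (zeros e) x<m))

  decrement-⊏ : ∀ e b τ → 0 < b → NonMax τ → zeros e ++ pred b ∷ τ ⊏ zeros e ++ b ∷ τ
  decrement-⊏ e (suc b) τ _ τ-nonMax
    rewrite core-zeros e (b ∷ τ) | core-zeros e (suc b ∷ τ) | lead-nonMax (suc b) τ τ-nonMax = by-case b
    where
    by-case : ∀ b → ×-Lex _≡_ _<_ (×-Lex _≡_ _<_ _<_)
      (length (core (b ∷ τ)) , lead (core (b ∷ τ)) , deficit (zeros e ++ b ∷ τ)) (suc (length τ) , suc b , deficit (zeros e ++ suc b ∷ τ))
    by-case zero    = inj₁ (s≤s (length-core τ))
    by-case (suc b) = inj₂ (refl , inj₁ (s≤s (lead-≤ (suc b) τ)))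

  prependZero-⊏ : ∀ γ → 0 ∷ γ ⊏ γ ∷ʳ m
  prependZero-⊏ γ = inj₁ (length-core-∷ʳ γ)

  -- The parent of an asymmetric bracelet

  lastNonMax-factor : ∀ xs → All (_≤ m) xs →
    (∃ λ t → xs ≡ max^ t) ⊎ (∃₂ λ ys x → ∃ λ t → xs ≡ ys ++ x ∷ max^ t × x < m)
  lastNonMax-factor []       []           = inj₁ (0 , refl)
  lastNonMax-factor (a ∷ xs) (a≤m ∷ xs≤m) with lastNonMax-factor xs xs≤m
  ... | inj₂ (ys , x , t , refl , x<m) = inj₂ (a ∷ ys , x , t , refl , x<m)
  ... | inj₁ (t , refl) with ℕ.m≤n⇒m<n∨m≡n a≤m
  ...   | inj₁ a<m  = inj₂ ([] , a , t , refl , a<m)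
  ...   | inj₂ refl = inj₁ (suc t , refl)

  lastNonMax≡ : ∀ xs t → x < m → lastNonMax (suc m) (xs ++ x ∷ max^ t) ≡ just (xs ++ suc x ∷ max^ t)
  lastNonMax≡ xs t x<m
    with last-index (λ a → ¬? (a ℕ.≟ m)) suc xs (ℕ.<⇒≢ x<m) (All.replicate⁺ t (λ m≢m → m≢m refl))
  ... | _ , eq , upd = map-just eq upd

  lastSymbol≡ : ∀ γ → (∀ u v → u ++ v ≡ 0 ∷ γ → 0 ∷ γ ≤ˡᵉˣ v ++ u) → lastSymbol (suc m) (γ ∷ʳ m) ≡ just (0 ∷ γ)
  lastSymbol≡ γ rot = map-just (unsnoc-∷ʳ (γ ∷ʳ m) refl)
    (trans (cong (λ z → smallestRotation (γ ∷ʳ z)) (n%n≡0 (suc m))) (smallestRotation-∷ʳ rot))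

  firstNonMin≡ : ∀ e b τ → 0 < b → firstNonMin (zeros e ++ b ∷ τ) ≡ just (zeros e ++ pred b ∷ τ)
  firstNonMin≡ e b τ 0<b = update-first (λ a → ¬? (a ℕ.≟ 0)) pred (zeros e)
    (All.replicate⁺ e (λ 0≢0 → 0≢0 refl)) (ℕ.<⇒≢ 0<b ∘ sym)

  secondLastNonMax≡ : ∀ xs → secondLastNonMax (suc m) (xs ++ 0 ∷ y ∷ m ∷ []) ≡ just (xs ++ 1 ∷ y ∷ m ∷ [])
  secondLastNonMax≡ xs
    with second-last-index (λ a → ¬? (a ℕ.≟ m)) suc xs (λ ()) (ℕ.<⇒≢ (ℕ.n<1+n y)) (λ m≢m → m≢m refl)
  ... | _ , eq , upd = map-just eq upd

  root-reduced : ∀ e → Reduced (zeros (suc e) ++ y ∷ m ∷ [])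
  root-reduced e = record { rotation = rot ; reflection = ref }
    where
    ω : String
    ω = zeros (suc e) ++ y ∷ m ∷ []

    ends⁺ : All (0 <_) (y ∷ m ∷ [])
    ends⁺ = 0<y ∷ s≤s z≤n ∷ []

    rot : ∀ u v → u ++ v ≡ ω → ω ≤ˡᵉˣ v ++ u
    rot []      v eq = ≤-reflexive (trans (sym eq) (sym (++-identityʳ v)))
    rot (b ∷ u) v eq with ++-split (b ∷ u) (zeros (suc e)) eq
    ... | inj₁ (w , eq₁ , refl) with zeros-++⁻ (suc e) (b ∷ u) w eq₁
    ...   | suc i , j , _ , refl , eq₂ = ≺⇒≤ (subst₂ _≺_ (replicate-∷ e 0 _) (sym (++-assoc (zeros j) _ (b ∷ u)))
      (zeros-≺ e j (subst (j ≤_) (sym (ℕ.suc-injective eq₂)) (ℕ.m≤n+m j i)) 0<y))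
    rot (b ∷ u) []      eq | inj₂ _ = ≤-reflexive (trans (sym eq) (++-identityʳ (b ∷ u)))
    rot (b ∷ u) (c ∷ v) eq | inj₂ (d , w , _ , eq₂) =
      this (All.head (All.++⁻ʳ (d ∷ w) (subst (All (0 <_)) eq₂ ends⁺)))

    ref : ∀ u v → u ++ v ≡ ω → ω ≺ reverse u ++ reverse v
    ref u v eq with ++-split u (zeros (suc e)) eq
    ... | inj₁ (w , eq₁ , refl) with zeros-++⁻ (suc e) u w eq₁
    ...   | i , j , refl , _ , eq₂ = subst (ω ≺_)
      (cong₂ _++_ (sym (reverse-replicate i 0)) (sym (reverse-mid w y [ m ])))
      (zeros-≺ (suc e) i (subst (i ≤_) (sym eq₂) (ℕ.m≤m+n i j)) (ℕ.n<1+n y))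
    ref u v eq | inj₂ (b , w , refl , eq₂) with subst (All (0 <_)) eq₂ ends⁺
    ... | 0<b ∷ ps = subst (λ z → ω ≺ z ++ reverse v) (sym (reverse-mid (zeros (suc e)) b w))
        (subst (ω ≺_) (sym (++-assoc (reverse w) _ _)) (<-head⇒≺ (All-reverse (All.++⁻ˡ w ps)) 0<b))

  module _ (n : ℕ) (3≤n : 3 ≤ n) where

    private
      k : ℕ
      k = suc m

      A : String → Set
      A = IsAsymmetricBracelet k n

      0<n : 0 < n
      0<n = ℕ.≤-trans (s≤s z≤n) 3≤n

    open IsAsymmetricBracelet

    root-asymmetricBracelet : A (root k n)
    root-asymmetricBracelet = root-member 3≤n
      where
      root-member : ∀ {n} → 3 ≤ n → IsAsymmetricBracelet k n (root k n)
      root-member {suc (suc (suc e))} (s≤s (s≤s (s≤s _))) = mkAsymmetricBracelet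
        (trans (length-++ (zeros (suc e))) (trans (cong (_+ 2) (length-replicate (suc e))) (ℕ.+-comm (suc e) 2)))
        (All.++⁺ (All.replicate⁺ (suc e) (s≤s z≤n)) (ℕ.m<n⇒m<1+n (ℕ.n<1+n y) ∷ ℕ.n<1+n m ∷ []))
        (reduced⇒isBracelet (root-reduced e))
        (reduced⇒¬isSymmetric (root-reduced e))

    replace-asymmetricBracelet : ∀ xs {a b ys} → b ≤ m → A (xs ++ a ∷ ys) → Reduced (xs ++ b ∷ ys) → A (xs ++ b ∷ ys)
    replace-asymmetricBracelet xs b≤m Aα r = mkAsymmetricBracelet
      (trans (length-replace xs) (length≡n Aα))
      (All.++⁺ (All.++⁻ˡ xs (alphabet Aα)) (s≤s b≤m ∷ All.tail (All.++⁻ʳ xs (alphabet Aα))))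
      (reduced⇒isBracelet r)
      (reduced⇒¬isSymmetric r)

    prependZero-asymmetricBracelet : ∀ γ → A (γ ∷ʳ m) → Reduced (0 ∷ γ) → A (0 ∷ γ)
    prependZero-asymmetricBracelet γ Aα r = mkAsymmetricBracelet
      (trans (sym (length-++-comm γ [ m ])) (length≡n Aα))
      (s≤s z≤n ∷ All.++⁻ˡ γ (alphabet Aα))
      (reduced⇒isBracelet r)
      (reduced⇒¬isSymmetric r)

    par≡find : A α → α ≢ root k n →
      par k n α ≡ find (isAsymmetricBracelet? k n)
        (catMaybes (lastNonMax k α ∷ lastSymbol k α ∷ firstNonMin α ∷ secondLastNonMax k α ∷ []))
    par≡find {α} Aα α≢r with isAsymmetricBracelet? k n α ×-dec ¬? (α ≟ˢ root k n)
    ... | yes _ = refl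
    ... | no ¬p = contradiction (Aα , α≢r) ¬p

    record ParentStep (α : String) : Set where
      field
        parent       : String
        par≡parent   : par k n α ≡ just parent
        parent∈A     : A parent
        parent⊏      : parent ⊏ α
        differ-first : HaveRotationsDifferingInFirstPosition α parent
        candidate    : Any A (lastNonMax k α) ⊎ Any A (lastSymbol k α) ⊎ Any A (firstNonMin α) ⊎ Any A (secondLastNonMax k α)

    private
      A? : Decidable A
      A? = isAsymmetricBracelet? k n

      any-just : ∀ {mα} → mα ≡ just β → A β → Any A mα
      any-just refl Aβ = just Aβ

    module _ {α β₁} (Aα : A α) (α≢r : α ≢ root k n) (eq₁ : lastNonMax k α ≡ just β₁) where

      private
        from₂ from₃ from₄ : List (Maybe String)
        from₄ = secondLastNonMax k α ∷ []
        from₃ = firstNonMin α ∷ from₄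
        from₂ = lastSymbol k α ∷ from₃

      step₁ : A β₁ → β₁ ⊏ α → HaveRotationsDifferingInFirstPosition α β₁ → ParentStep α
      step₁ Aβ β⊏ d = record
        { parent = β₁ ; par≡parent = par≡ ; parent∈A = Aβ ; parent⊏ = β⊏ ; differ-first = d ; candidate = inj₁ (any-just eq₁ Aβ) }
        where
        par≡ : par k n α ≡ just β₁
        par≡ = trans (par≡find Aα α≢r) (find-accept A? _ from₂ eq₁ Aβ)

      module _ {β₂} (¬Aβ₁ : ¬ A β₁) (eq₂ : lastSymbol k α ≡ just β₂) where

        step₂ : A β₂ → β₂ ⊏ α → HaveRotationsDifferingInFirstPosition α β₂ → ParentStep α
        step₂ Aβ β⊏ d = record
          { parent = β₂ ; par≡parent = par≡ ; parent∈A = Aβ ; parent⊏ = β⊏ ; differ-first = d ; candidate = inj₂ (inj₁ (any-just eq₂ Aβ)) }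
          where
          par≡ : par k n α ≡ just β₂
          par≡ = trans (par≡find Aα α≢r) (trans (find-reject A? _ from₂ eq₁ ¬Aβ₁) (find-accept A? _ from₃ eq₂ Aβ))

        module _ {β₃} (¬Aβ₂ : ¬ A β₂) (eq₃ : firstNonMin α ≡ just β₃) where

          step₃ : A β₃ → β₃ ⊏ α → HaveRotationsDifferingInFirstPosition α β₃ → ParentStep α
          step₃ Aβ β⊏ d = record
            { parent = β₃ ; par≡parent = par≡ ; parent∈A = Aβ ; parent⊏ = β⊏ ; differ-first = d ; candidate = inj₂ (inj₂ (inj₁ (any-just eq₃ Aβ))) }
            where
            par≡ : par k n α ≡ just β₃
            par≡ = trans (par≡find Aα α≢r) (trans (find-reject A? _ from₂ eq₁ ¬Aβ₁)
              (trans (find-reject A? _ from₃ eq₂ ¬Aβ₂) (find-accept A? _ from₄ eq₃ Aβ)))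

          step₄ : ∀ {β₄} → ¬ A β₃ → secondLastNonMax k α ≡ just β₄ →
            A β₄ → β₄ ⊏ α → HaveRotationsDifferingInFirstPosition α β₄ → ParentStep α
          step₄ {β₄} ¬Aβ₃ eq₄ Aβ β⊏ d = record
            { parent = β₄ ; par≡parent = par≡ ; parent∈A = Aβ ; parent⊏ = β⊏ ; differ-first = d ; candidate = inj₂ (inj₂ (inj₂ (any-just eq₄ Aβ))) }
            where
            par≡ : par k n α ≡ just β₄
            par≡ = trans (par≡find Aα α≢r) (trans (find-reject A? _ from₂ eq₁ ¬Aβ₁)
              (trans (find-reject A? _ from₃ eq₂ ¬Aβ₂) (trans (find-reject A? _ from₄ eq₃ ¬Aβ₃) (find-accept A? _ [] eq₄ Aβ))))

    descent-step : ∀ {β₁ β₂} → A α → α ≢ root k n →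
      lastNonMax k α ≡ just β₁ → ¬ A β₁ → lastSymbol k α ≡ just β₂ → ¬ A β₂ → Descent α → ParentStep α
    descent-step Aα α≢r eq₁ ¬Aβ₁ eq₂ ¬Aβ₂ (descent e b@(suc b′) τ refl 0<b τ-nonMax red) with A? (zeros e ++ b′ ∷ τ)
    ... | yes Aβ₃ = step₃ Aα α≢r eq₁ ¬Aβ₁ eq₂ ¬Aβ₂ (firstNonMin≡ e b τ 0<b) Aβ₃
      (decrement-⊏ e b τ 0<b τ-nonMax) (replace-differ (zeros e) (ℕ.1+n≢n))
    ... | no ¬Aβ₃ with red
    ...   | inj₁ r = contradiction (replace-asymmetricBracelet (zeros e)
      (ℕ.<⇒≤ (s≤s⁻¹ (All.head (All.++⁻ʳ (zeros e) (alphabet Aα))))) Aα r) ¬Aβ₃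
    ...   | inj₂ (xs , eq , xs⁺ , r) = step₄ Aα α≢r eq₁ ¬Aβ₁ eq₂ ¬Aβ₂ (firstNonMin≡ e b τ 0<b) ¬Aβ₃
      (trans (cong (secondLastNonMax k) eq) (secondLastNonMax≡ xs))
      (replace-asymmetricBracelet xs (s≤s z≤n) (subst A eq Aα) r)
      (subst (xs ++ 1 ∷ y ∷ m ∷ [] ⊏_) (sym eq) (increment-⊏ xs xs⁺ (s≤s z≤n)))
      (subst (λ z → HaveRotationsDifferingInFirstPosition z (xs ++ 1 ∷ y ∷ m ∷ [])) (sym eq) (replace-differ xs (λ ())))

    root-shape : A α → ∀ e → α ≡ zeros e ++ y ∷ m ∷ [] → α ≡ root k n
    root-shape Aα e refl = cong (λ i → zeros i ++ y ∷ m ∷ []) (sym (begin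
      n ∸ 2                                    ≡⟨ cong (_∸ 2) (length≡n Aα) ⟨
      length (zeros e ++ y ∷ m ∷ []) ∸ 2       ≡⟨ cong (_∸ 2) (length-++ (zeros e)) ⟩
      length (zeros e) + 2 ∸ 2                 ≡⟨ ℕ.m+n∸n≡m (length (zeros e)) 2 ⟩
      length (zeros e)                         ≡⟨ length-replicate e ⟩
      e                                        ∎))
      where open ≡-Reasoning

    -- Here `t` counts the maximal symbols left once the last one is removed, so `s ≤ t` is the
    -- strict inequality obtained from the failed increment, and the remaining case becomes `s ≡ t`.
    palindrome-step : ∀ P s t {β₁} → reverse P ≡ P → s ≤ t →
      let ω = (P ++ plateau s t) ∷ʳ m in
      A ω → ω ≢ root k n → lastNonMax k ω ≡ just β₁ → ¬ A β₁ → ParentStep ω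
    palindrome-step P s t pal s≤t Aω ω≢r eq₁ ¬Aβ₁ = by-case (A? (0 ∷ δ))
      where
      δ ω : String
      δ = P ++ plateau s t
      ω = δ ∷ʳ m

      r : Reduced ω
      r = asymmetricBracelet⇒reduced 0<n Aω

      eq₂ : lastSymbol k ω ≡ just (0 ∷ δ)
      eq₂ = lastSymbol≡ δ (prependZero-rotation P (plateau s t) (plateau⁺ s t) (plateau-positive s t) r)

      P≤m : All (_≤ m) P
      P≤m = All.map s≤s⁻¹ (All.++⁻ˡ P (All.++⁻ˡ δ (alphabet Aω)))

      -- `s` and `t` are quantified anew so that the equation can be matched and `s` split.
      last-resort : ∀ s t → s ≡ t → let ω = (P ++ plateau s t) ∷ʳ m in
        A ω → Reduced ω → ω ≢ root k n → (∃₂ λ e P₁ → P ≡ zeros e ++ P₁ × reverse (P₁ ++ plateau s t) ≤ˡᵉˣ P₁ ++ plateau s t) → Descent ω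
      last-resort zero    _ refl Aω r ω≢r (e , P₁ , P≡ , fail) with narrow-descent P e P₁ pal P≡ P≤m r fail
      ... | inj₁ (e′ , eq) = contradiction (root-shape Aω e′ eq) ω≢r
      ... | inj₂ d         = d
      last-resort (suc s) _ refl Aω r ω≢r (e , P₁ , P≡ , fail) = wide-descent P pal P≤m e P₁ P≡ s r fail

      by-case : Dec (A (0 ∷ δ)) → ParentStep ω
      by-case (yes Aβ₂) = step₂ Aω ω≢r eq₁ ¬Aβ₁ eq₂ Aβ₂ (prependZero-⊏ δ)
        (m , 0 , δ , (λ ()) , ∷-∈-rotations δ m [] , subst (_∈ rotations (0 ∷ δ)) (cong (0 ∷_) (++-identityʳ δ)) (∷-∈-rotations [] 0 δ))
      by-case (no ¬Aβ₂) with prependZero-reduced P (plateau s t) (plateau⁺ s t) (plateau-positive s t) r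
      ... | inj₁ r₂ = contradiction (prependZero-asymmetricBracelet δ Aω r₂) ¬Aβ₂
      ... | inj₂ f@(e , P₁ , P≡ , fail) = descent-step Aω ω≢r eq₁ ¬Aβ₁ eq₂ ¬Aβ₂ (last-resort s t (ℕ.≤-antisym s≤t t≤s) Aω r ω≢r f)
        where
        t≤s : t ≤ s
        t≤s = squeeze-max s t (P₁ ++ plateau s t)
          (subst (_≤ˡᵉˣ P₁ ++ plateau s t) (reverse-plateau P pal P≤m e P₁ P≡ s t) fail)
          (subst ((P₁ ++ plateau s t) ∷ʳ m ≤ˡᵉˣ_)
            (trans (++-assoc (plateau s t) [ m ] (reverse P₁)) (++-assoc (max^ s) (y ∷ max^ t) (m ∷ reverse P₁)))
            (rotation-at-zeros P pal P≤m e P₁ P≡ (plateau s t) r))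

    plateau-∷ʳ : ∀ P s t → (P ++ max^ s) ++ y ∷ max^ (suc t) ≡ (P ++ plateau s t) ∷ʳ m
    plateau-∷ʳ P s t = begin
      (P ++ max^ s) ++ y ∷ m ∷ max^ t        ≡⟨ cong (λ z → (P ++ max^ s) ++ y ∷ z) (replicate-∷ʳ t m) ⟨
      (P ++ max^ s) ++ (y ∷ max^ t) ∷ʳ m     ≡⟨ ++-assoc (P ++ max^ s) (y ∷ max^ t) [ m ] ⟨
      ((P ++ max^ s) ++ y ∷ max^ t) ∷ʳ m     ≡⟨ cong (_∷ʳ m) (++-assoc P (max^ s) (y ∷ max^ t)) ⟩
      (P ++ plateau s t) ∷ʳ m                ∎
      where open ≡-Reasoning

    parentStep : A α → α ≢ root k n → ParentStep α
    parentStep {α} Aα α≢r with lastNonMax-factor α (All.map s≤s⁻¹ (alphabet Aα))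
    ... | inj₁ (t , refl) = contradiction
      (subst (max^ t ≺_) (reverse-replicate t m) (reflection (asymmetricBracelet⇒reduced 0<n Aα) [] (max^ t) refl)) ≺-irrefl
    ... | inj₂ (xs , x , t , refl , x<m) with A? (xs ++ suc x ∷ max^ t)
    ...   | yes Aβ₁ = step₁ Aα α≢r (lastNonMax≡ xs t x<m) Aβ₁
      (incrementLast-⊏ xs t x<m (asymmetricBracelet⇒reduced 0<n Aα)) (replace-differ xs (ℕ.1+n≢n ∘ sym))
    ...   | no ¬Aβ₁ with increment-reduced xs t (All.map s≤s⁻¹ (All.++⁻ˡ xs (alphabet Aα))) x<m (asymmetricBracelet⇒reduced 0<n Aα)
    ...     | inj₁ r₁ = contradiction (replace-asymmetricBracelet xs x<m Aα r₁) ¬Aβ₁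
    ...     | inj₂ (P , s , refl , pal , s≤s s≤t , refl) = subst ParentStep (sym ω≡)
      (palindrome-step P s _ pal s≤t (subst A ω≡ Aα) (subst (_≢ root k n) ω≡ α≢r)
        (trans (cong (lastNonMax k) (sym ω≡)) (lastNonMax≡ (P ++ max^ s) t x<m)) ¬Aβ₁)
      where
      ω≡ : (P ++ max^ s) ++ y ∷ max^ t ≡ (P ++ plateau s (pred t)) ∷ʳ m
      ω≡ = plateau-∷ʳ P s (pred t)

    -- Walks to the root

    par-domain : par k n α ≡ just β → A α × α ≢ root k n
    par-domain {α} eq with isAsymmetricBracelet? k n α ×-dec ¬? (α ≟ˢ root k n)
    par-domain eq | yes p = p
    par-domain () | no _

    open ParentStep

    par-parent : (Aα : A α) (α≢r : α ≢ root k n) → par k n α ≡ just β → β ≡ parent (parentStep Aα α≢r)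
    par-parent Aα α≢r eq = just-injective (trans (sym eq) (par≡parent (parentStep Aα α≢r)))

    _⟶_ : Rel String 0ℓ
    α ⟶ β = par k n α ≡ just β

    walk-to-root : Acc _⊏_ α → A α → ∃ λ vs → Walk _⟶_ α (root k n) vs
    walk-to-root {α} (acc rec) Aα with α ≟ˢ root k n
    ... | yes refl = _ , stop
    ... | no α≢r with parentStep Aα α≢r
    ...   | p with walk-to-root (rec (parent⊏ p)) (parent∈A p)
    ...     | vs , W = _ , step (par≡parent p) W

    -- No walk leaves the root, where `par` is undefined, and elsewhere `par` determines the next
    -- vertex.
    walk-unique : ∀ {vs ws} → Walk _⟶_ α (root k n) vs → Walk _⟶_ α (root k n) ws → vs ≡ ws
    walk-unique stop       stop       = refl
    walk-unique stop       (step p _) = contradiction refl (proj₂ (par-domain p))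
    walk-unique (step p _) stop       = contradiction refl (proj₂ (par-domain p))
    walk-unique (step p W) (step q X) with just-injective (trans (sym p) q)
    ... | refl = cong (_ ∷_) (walk-unique W X)

    walk⇒par^ : ∀ {vs} → Walk _⟶_ α β vs → ∃ λ t → par^ k n t α ≡ just β
    walk⇒par^ stop = 0 , refl
    walk⇒par^ (step p W) with walk⇒par^ W
    ... | t , eq = suc t , trans (cong (Maybe._>>= par^ k n t) p) eq

    isRootedTree : IsRootedTree _⟶_ A (root k n)
    isRootedTree = record
      { root-vertex   = root-asymmetricBracelet
      ; edge-vertices = λ p → let Aα , α≢r = par-domain p in
          Aα , subst A (sym (par-parent Aα α≢r p)) (parent∈A (parentStep Aα α≢r))
      ; unique-walk   = λ Aα → let vs , W = walk-to-root (⊏-wellFounded _) Aα in vs , W , walk-unique W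
      }

    parentRule :
      (∀ α → A α → α ≢ root k n →
        (Any A (lastNonMax k α) ⊎ Any A (lastSymbol k α) ⊎ Any A (firstNonMin α) ⊎ Any A (secondLastNonMax k α))
        × (∃ λ β → par k n α ≡ just β × A β))
      × (∀ α → A α → ∃ λ t → par^ k n t α ≡ just (root k n))
      × IsRootedTree _⟶_ A (root k n)
      × (∀ α β → A α → α ≢ root k n → par k n α ≡ just β → HaveRotationsDifferingInFirstPosition α β)
    parentRule =
        (λ α Aα α≢r → let p = parentStep Aα α≢r in candidate p , parent p , par≡parent p , parent∈A p)
      , (λ α Aα → walk⇒par^ (proj₂ (walk-to-root (⊏-wellFounded α) Aα)))
      , isRootedTree
      , (λ α β Aα α≢r eq → subst (HaveRotationsDifferingInFirstPosition α) (sym (par-parent Aα α≢r eq)) (differ-first (parentStep Aα α≢r)))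

mainTheorem9 : (n k : ℕ) .{{_ : NonZero k}} → 3 ≤ n → 3 ≤ k →
    let A = IsAsymmetricBracelet k n
        r = root k n
        Par = par k n
        Par^ = par^ k n
    in (∀ α → A α → α ≢ r →
         (Any A (lastNonMax k α) ⊎ Any A (lastSymbol k α) ⊎ Any A (firstNonMin α) ⊎ Any A (secondLastNonMax k α))
         × (∃ λ β → Par α ≡ just β × A β))
     × (∀ α → A α → ∃ λ t → Par^ t α ≡ just r)
     × IsRootedTree (λ α β → Par α ≡ just β) A r
     × (∀ α β → A α → α ≢ r → Par α ≡ just β → HaveRotationsDifferingInFirstPosition α β)
mainTheorem9 n (suc (suc (suc k))) 3≤n (s≤s (s≤s (s≤s _))) = parentRule (suc k) (s≤s z≤n) n 3≤n
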